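{- Let $s,t$ be coprime integers greater than $1$, let $\sigma$ be an $s$-core, $\tau$ a $t$-core and $n\ge0$. The following are equivalent: (1) $|\mathcal P_{\sigma,\tau}(n)|=1$; (2) $\mathrm{cor}_t(\sigma)=\mathrm{cor}_s(\tau)$ and $n=|\sigma|+|\tau|-|\mathrm{cor}_t(\sigma)|$; (3) $n=m_{\sigma,\tau}=|\tau|+t\,\mathrm{wei}_t(\sigma)$; (4) $n=m_{\sigma,\tau}=|\sigma|+s\,\mathrm{wei}_s(\tau)$.
   Context: Partitions, size $|\lambda|$. A rim $s$-hook is a connected set of $s$ nodes of the rim of the Young diagram (nodes $(r,c)$ with $(r+1,c+1)$ not a node) whose removal leaves a partition's diagram; $\lambda$ is an $s$-core if it has no rim $s$-hook. The $s$-core $\mathrm{cor}_s(\lambda)$ is obtained by repeatedly removing rim $s$-hooks, and the $s$-weight $\mathrm{wei}_s(\lambda)$ is the number removed. $\mathcal P_{\sigma,\tau}(n)$ is the set of partitions of $n$ with $s$-core $\sigma$ and $t$-core $\tau$. $m_{\sigma,\tau}$ denotes the smallest $n$ for which $\mathcal P_{\sigma,\tau}(n)\neq\emptyset$. -}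

module Defs where

open import Data.Nat using (ℕ; zero; suc; _+_; _*_; _∸_; _<_; _≤_; _≥_)
open import Data.Nat.Coprimality public using (Coprime)
open import Data.List using (List; []; _∷_; length)
open import Data.Nat.ListAction using (sum)
open import Data.List.Membership.Propositional using (_∈_; _∉_)
open import Data.List.Relation.Unary.All using (All)
open import Data.List.Relation.Unary.Linked using (Linked)
open import Data.List.Relation.Unary.Unique.Propositional using (Unique)
open import Data.Product using (Σ; ∃; ∃-syntax; _×_; _,_)
open import Data.Sum using (_⊎_)
open import Relation.Binary.PropositionalEquality using (_≡_)
open import Relation.Nullary using (¬_)
open import Function.Bundles public using (_⇔_)

IsPartition : List ℕ → Set
IsPartition λ′ = Linked _≥_ λ′ × All (λ p → 1 ≤ p) λ′

size : List ℕ → ℕ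
size = sum

part : List ℕ → ℕ → ℕ
part []       _       = 0
part (p ∷ _)  zero    = p
part (_ ∷ ps) (suc r) = part ps r

-- Nodes (row , column), 0-indexed.
Node : Set
Node = ℕ × ℕ

_∈ᴰ_ : Node → List ℕ → Set
(r , c) ∈ᴰ λ′ = c < part λ′ r

IsRimNode : List ℕ → Node → Set
IsRimNode λ′ (r , c) = ((r , c) ∈ᴰ λ′) × ¬ ((suc r , suc c) ∈ᴰ λ′)

Adj : Node → Node → Set
Adj (r , c) (r′ , c′) =
  (r ≡ r′ × (suc c ≡ c′ ⊎ suc c′ ≡ c)) ⊎ (c ≡ c′ × (suc r ≡ r′ ⊎ suc r′ ≡ r))

data Path (H : List Node) : Node → Node → Set where
  here : ∀ {x} → Path H x x
  step : ∀ {x z y} → Adj x z → z ∈ H → Path H z y → Path H x y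

Connected : List Node → Set
Connected H = ∀ {x y} → x ∈ H → y ∈ H → Path H x y

RemovesHook : ℕ → List ℕ → List ℕ → Set
RemovesHook s λ′ μ =
  IsPartition μ ×
  Σ (List Node) λ H →
    Unique H × length H ≡ s × All (IsRimNode λ′) H × Connected H ×
    (∀ x → (x ∈ᴰ μ → (x ∈ᴰ λ′ × x ∉ H)) × ((x ∈ᴰ λ′ × x ∉ H) → x ∈ᴰ μ))

IsCore : ℕ → List ℕ → Set
IsCore s λ′ = ¬ (∃[ μ ] RemovesHook s λ′ μ)

data Reduces (s : ℕ) : List ℕ → List ℕ → ℕ → Set where
  done : ∀ {λ′} → Reduces s λ′ λ′ 0
  rem  : ∀ {λ′ μ κ w} → RemovesHook s λ′ μ → Reduces s μ κ w → Reduces s λ′ κ (suc w)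

CoreWeight : ℕ → List ℕ → List ℕ → ℕ → Set
CoreWeight s λ′ κ w = Reduces s λ′ κ w × IsCore s κ

HasCore : ℕ → List ℕ → List ℕ → Set
HasCore s λ′ κ = ∃[ w ] CoreWeight s λ′ κ w

HasWeight : ℕ → List ℕ → ℕ → Set
HasWeight s λ′ w = ∃[ κ ] CoreWeight s λ′ κ w

InP : ℕ → ℕ → List ℕ → List ℕ → ℕ → List ℕ → Set
InP s t σ τ n λ′ = IsPartition λ′ × size λ′ ≡ n × HasCore s λ′ σ × HasCore t λ′ τ

UniqueInP : ℕ → ℕ → List ℕ → List ℕ → ℕ → Set
UniqueInP s t σ τ n = ∃[ λ′ ] (InP s t σ τ n λ′ × (∀ μ → InP s t σ τ n μ → μ ≡ λ′))

NonemptyP : ℕ → ℕ → List ℕ → List ℕ → ℕ → Set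
NonemptyP s t σ τ n = ∃[ λ′ ] InP s t σ τ n λ′

IsMinimal : ℕ → ℕ → List ℕ → List ℕ → ℕ → Set
IsMinimal s t σ τ n = NonemptyP s t σ τ n × (∀ k → k < n → ¬ NonemptyP s t σ τ k)

{-# OPTIONS --safe #-}
module Submission where

-- Encode a partition by its beads, one at λ_r - r for each row r. Removing a rim d-hook
-- moves a bead from b + d to a free position b, so moves commute and d-cores are unique.
--
-- Fix a residue class U mod s and exchange the positions x and x + t for all x in U. This
-- involution θ preserves t-cores and commutes with s-moves, so |θλ| - |θσ| = |λ| - |σ| if
-- σ is the s-core of λ. If σ is an s-core with x free and x + t occupied, then θ for the
-- class of x makes σ smaller. Iterating gives a bijection, with a constant shift of sizes,
-- from the partitions with cores (σ , τ) to those with cores (κ , τ), where κ = cor_t σ is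
-- both an s-core and a t-core.
--
-- Let λ have cores (κ , τ), and suppose λ is not a t-core, say with x free and x + t occupied.
-- Then some x′ ≡ x mod s has x′ occupied and x′ + t free: otherwise |θλ| < |λ| while
-- |θκ| ≥ |κ|. Moving x + t to x and x′ to x′ + t keeps size and both cores, so λ is not the
-- only partition of its size. Hence uniqueness holds exactly when λ = τ, that is cor_s τ = κ
-- and the size is the least possible one.

open import Defs
open import Data.Bool using (Bool; true; false; _∨_)
import Data.Bool.Properties as Bool
open import Data.Integer as ℤ using (ℤ; +_; -[1+_]; +[1+_]; 0ℤ; 1ℤ; +<+; +≤+)
open import Data.Integer.Divisibility.Signed using (_∣_; _∣?_; divides; ∣m∣n⇒∣m+n; ∣m∣n⇒∣m-n; ∣-refl; ∣⇒∣ᵤ)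
import Data.Integer.Properties as ℤ
open import Algebra.Properties.AbelianGroup ℤ.+-0-abelianGroup using () renaming (∙-cancelˡ to +-cancelˡ; ∙-cancelʳ to +-cancelʳ)
open import Data.Integer.Tactic.RingSolver using (solve-∀)
open import Data.List using (List; []; _∷_; _++_; length; map; applyUpTo; replicate)
import Data.List.Membership.DecPropositional as DecMembership
open import Data.List.Membership.Propositional using (_∈_; _∉_)
open import Data.List.Membership.Propositional.Properties using (∈-++⁺ˡ; ∈-++⁺ʳ; ∈-++⁻; ∈-map⁺; ∈-map⁻; ∈-applyUpTo⁺; ∈-applyUpTo⁻)
open import Data.List.Membership.Propositional.Properties.WithK using (unique∧set⇒bag)
open import Data.List.Properties using (length-++; length-map; length-applyUpTo)
open import Data.List.Relation.Binary.BagAndSetEquality using (∼bag⇒↭)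
open import Data.List.Relation.Binary.Permutation.Propositional.Properties using (↭-length)
open import Data.List.Relation.Unary.All as All using ([]; _∷_)
open import Data.List.Relation.Unary.AllPairs using ([])
open import Data.List.Relation.Unary.Any using (here)
open import Data.List.Relation.Unary.Linked as Linked using (Linked; []; [-]; _∷_)
open import Data.List.Relation.Unary.Unique.Propositional using (Unique)
import Data.List.Relation.Unary.Unique.Propositional.Properties as Unique
open import Data.Nat as ℕ using (ℕ; zero; suc; z≤n; s≤s; s≤s⁻¹)
import Data.Nat.Coprimality as Coprimality
import Data.Nat.Divisibility as ℕ
import Data.Nat.Properties as ℕ
import Data.Nat.Tactic.RingSolver as ℕSolver
open import Data.Product using (∃; ∃-syntax; _×_; _,_; proj₁; proj₂)
open import Data.Product.Properties using (≡-dec)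
open import Data.Sum as Sum using (_⊎_; inj₁; inj₂)
open import Function using (_∘_; id)
open import Function.Bundles using (mk⇔; Equivalence)
open import Relation.Binary.Definitions using (tri<; tri≈; tri>)
open import Relation.Binary.PropositionalEquality using (_≡_; _≢_; _≗_; refl; sym; trans; cong; cong₂; subst; subst₂; module ≡-Reasoning)
open import Relation.Nullary using (¬_; Dec; yes; no; contradiction; _×-dec_)
open import Relation.Nullary.Decidable using (⌊_⌋)
open import Relation.Unary using (Decidable)

-- A partition is determined by its beads, but `size` is never computed from them: sizes are
-- compared only through single hook moves. The exchange θ touches infinitely many positions, so it
-- is realised by sweeping a cut upwards, one pair at a time; far down both members of a pair are
-- occupied and far up both are free, so finitely many exchanges matter. An exchange enlarges the
-- partition only where x is occupied and x + t is free, and therefore every size estimate is a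
-- dichotomy: such a pair exists, or |θλ| is at most |λ|. For the s-cores to which θ is applied the
-- first alternative fails, because the beads of an s-core are pushed down in each class.
-- Coprimality enters as s ∤ t: x and x + t never share a class, so θ is an involution.

-- Rim hooks described row by row

module Ribbons where

  open import Data.Nat using (_+_; _∸_; _<_; _≤_; _≥_)

  -- Zero parts are allowed: the bead of an empty row can be moved only when that row is present in
  -- the list.
  WD : List ℕ → Set
  WD = Linked _≥_

  part-≤-head : ∀ {p ps} → WD (p ∷ ps) → part ps 0 ≤ p
  part-≤-head [-]     = z≤n
  part-≤-head (p ∷ _) = p

  wd-∷ : ∀ {p ps} → part ps 0 ≤ p → WD ps → WD (p ∷ ps)
  wd-∷ {ps = []}    _ _ = [-]
  wd-∷ {ps = _ ∷ _} h w = h ∷ w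

  part-antitone : ∀ {ps} → WD ps → ∀ r → part ps (suc r) ≤ part ps r
  part-antitone []      r       = z≤n
  part-antitone [-]     r       = z≤n
  part-antitone (h ∷ w) zero    = h
  part-antitone (h ∷ w) (suc r) = part-antitone w r

  down : Node → Node
  down (r , c) = suc r , c

  skew : List ℕ → (ℕ → ℕ) → List Node
  skew []       g = []
  skew (p ∷ ps) g = applyUpTo (λ i → 0 , g 0 + i) (p ∸ g 0) ++ map down (skew ps (g ∘ suc))

  ∈-skew⁻ : ∀ ps g {r c} → (r , c) ∈ skew ps g → g r ≤ c × c < part ps r
  ∈-skew⁻ (p ∷ ps) g m with ∈-++⁻ (applyUpTo _ (p ∸ g 0)) m
  ... | inj₁ m₀ with i , i< , refl ← ∈-applyUpTo⁻ _ m₀ =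
    ℕ.m≤m+n (g 0) i , ℕ.<-≤-trans (ℕ.+-monoʳ-< (g 0) i<)
      (ℕ.≤-reflexive (ℕ.m+[n∸m]≡n (ℕ.<⇒≤ (ℕ.m∸n≢0⇒n<m {p} {g 0} λ eq → ℕ.n≮0 (subst (i <_) eq i<)))))
  ... | inj₂ m₁ with _ , m₂ , refl ← ∈-map⁻ down m₁ = ∈-skew⁻ ps (g ∘ suc) m₂

  ∈-skew⁺ : ∀ ps g {r c} → g r ≤ c → c < part ps r → (r , c) ∈ skew ps g
  ∈-skew⁺ (p ∷ ps) g {zero} {c} g≤c c<p =
    ∈-++⁺ˡ (subst (λ z → (0 , z) ∈ applyUpTo (λ i → 0 , g 0 + i) (p ∸ g 0)) (ℕ.m+[n∸m]≡n g≤c)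
        (∈-applyUpTo⁺ _ (ℕ.∸-monoˡ-< c<p g≤c)))
  ∈-skew⁺ (p ∷ ps) g {suc r} g≤c c<p = ∈-++⁺ʳ _ (∈-map⁺ down (∈-skew⁺ ps (g ∘ suc) g≤c c<p))

  skew-unique : ∀ ps g → Unique (skew ps g)
  skew-unique []       g = []
  skew-unique (p ∷ ps) g = Unique.++⁺
    (Unique.applyUpTo⁺₁ _ _ λ i<j _ eq → ℕ.<⇒≢ i<j (ℕ.+-cancelˡ-≡ (g 0) _ _ (cong proj₂ eq)))
    (Unique.map⁺ (λ { refl → refl }) (skew-unique ps (g ∘ suc)))
    λ (m₀ , m₁) → disjoint m₀ m₁
    where
    disjoint : ∀ {x} → x ∈ applyUpTo (λ i → 0 , g 0 + i) (p ∸ g 0) → ¬ x ∈ map down (skew ps (g ∘ suc))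
    disjoint m₀ m₁ with _ , _ , refl ← ∈-applyUpTo⁻ _ m₀ with _ , _ , () ← ∈-map⁻ down m₁

  length-skew-∷ : ∀ p ps g → length (skew (p ∷ ps) g) ≡ (p ∸ g 0) + length (skew ps (g ∘ suc))
  length-skew-∷ p ps g = trans (length-++ (applyUpTo _ (p ∸ g 0)))
    (cong₂ _+_ (length-applyUpTo _ (p ∸ g 0)) (length-map down (skew ps (g ∘ suc))))

  length-skew-self : ∀ ps → length (skew ps (part ps)) ≡ 0
  length-skew-self []       = refl
  length-skew-self (p ∷ ps) = trans (length-skew-∷ p ps (part (p ∷ ps))) (cong₂ _+_ (ℕ.n∸n≡0 p) (length-skew-self ps))

  -- Parts lists padded to a common length; the removed hook starts in the first row.
  data Ribbon : ℕ → List ℕ → List ℕ → Set where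
    last : ∀ {c d ps} → Ribbon (suc d) (c + suc d ∷ ps) (c ∷ ps)
    more : ∀ {d e q qs ms} → Ribbon d (suc q ∷ qs) ms → Ribbon (suc e + d) (q + suc e ∷ suc q ∷ qs) (q ∷ ms)

  -- Hook d b λ μ: the bead at b + d moves to b.
  data Hook (d : ℕ) : ℤ → List ℕ → List ℕ → Set where
    start : ∀ {b p ps qs} → b ℤ.+ + d ≡ + p → Ribbon d (p ∷ ps) qs → Hook d b (p ∷ ps) qs
    skip  : ∀ {b p ps qs} → Hook d (ℤ.suc b) ps qs → Hook d b (p ∷ ps) (p ∷ qs)

  ribbon-length : ∀ {d ps qs} → Ribbon d ps qs → length (skew ps (part qs)) ≡ d
  ribbon-length (last {c} {d} {ps}) = trans (length-skew-∷ (c + suc d) ps (part (c ∷ ps)))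
    (trans (cong₂ _+_ (ℕ.m+n∸m≡n c (suc d)) (length-skew-self ps)) (ℕ.+-identityʳ _))
  ribbon-length (more {d} {e} {q} {qs} {ms} R) = trans (length-skew-∷ (q + suc e) (suc q ∷ qs) (part (q ∷ ms)))
    (cong₂ _+_ (ℕ.m+n∸m≡n q (suc e)) (ribbon-length R))

  hook-length : ∀ {d b ps qs} → Hook d b ps qs → length (skew ps (part qs)) ≡ d
  hook-length (start _ R) = ribbon-length R
  hook-length (skip {p = p} {ps} {qs} h) = trans (length-skew-∷ p ps (part (p ∷ qs)))
      (cong₂ _+_ (ℕ.n∸n≡0 p) (hook-length h))

  ribbon-size : ∀ {d ps qs} → Ribbon d ps qs → size ps ≡ size qs + d
  ribbon-size (last {c} {d} {ps}) = trans (ℕ.+-assoc c (suc d) (size ps))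
    (trans (cong (λ z → c + z) (ℕ.+-comm (suc d) (size ps))) (sym (ℕ.+-assoc c (size ps) (suc d))))
  ribbon-size (more {d} {e} {q} {qs} {ms} R) = trans (cong (λ z → (q + suc e) + z) (ribbon-size R))
      (lemma q e (size ms) d)
    where
    lemma : ∀ q e m d → (q + suc e) + (m + d) ≡ (q + m) + (suc e + d)
    lemma = ℕSolver.solve-∀

  hook-size : ∀ {d b ps qs} → Hook d b ps qs → size ps ≡ size qs + d
  hook-size (start _ R) = ribbon-size R
  hook-size (skip {p = p} h) = trans (cong (λ z → p + z) (hook-size h)) (sym (ℕ.+-assoc p _ _))

  ribbon-⊆ : ∀ {d ps qs} → Ribbon d ps qs → ∀ r → part qs r ≤ part ps r
  ribbon-⊆ (last {c} {d}) zero    = ℕ.m≤m+n c (suc d)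
  ribbon-⊆ last           (suc r) = ℕ.≤-refl
  ribbon-⊆ (more {q = q} R) zero    = ℕ.m≤m+n q _
  ribbon-⊆ (more R)       (suc r) = ribbon-⊆ R r

  hook-⊆ : ∀ {d b ps qs} → Hook d b ps qs → ∀ r → part qs r ≤ part ps r
  hook-⊆ (start _ R) r       = ribbon-⊆ R r
  hook-⊆ (skip h)  zero    = ℕ.≤-refl
  hook-⊆ (skip h)  (suc r) = hook-⊆ h r

  -- In every row but the last of the ribbon, the row is cut to `q` and the next old part is
  -- `suc q`, by construction. In the last row the bound comes from the new list being weakly
  -- decreasing.
  ribbon-rim : ∀ {d ps qs} → Ribbon d ps qs → WD qs → ∀ r → part qs r < part ps r → part ps (suc r) ≤ suc (part qs r)
  ribbon-rim last w zero    _ = ℕ.m≤n⇒m≤1+n (part-≤-head w)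
  ribbon-rim last w (suc r) h = contradiction h (ℕ.<-irrefl refl)
  ribbon-rim (more R) w zero    _ = ℕ.≤-refl
  ribbon-rim (more R) w (suc r) h = ribbon-rim R (Linked.tail w) r h

  hook-rim : ∀ {d b ps qs} → Hook d b ps qs → WD qs → ∀ r → part qs r < part ps r → part ps (suc r) ≤ suc (part qs r)
  hook-rim (start _ R) w r       h = ribbon-rim R w r h
  hook-rim (skip k)  w zero    h = contradiction h (ℕ.<-irrefl refl)
  hook-rim (skip k)  w (suc r) h = hook-rim k (Linked.tail w) r h

  adj-sym : ∀ {x y} → Adj x y → Adj y x
  adj-sym (inj₁ (refl , inj₁ e)) = inj₁ (refl , inj₂ e)
  adj-sym (inj₁ (refl , inj₂ e)) = inj₁ (refl , inj₁ e)
  adj-sym (inj₂ (refl , inj₁ e)) = inj₂ (refl , inj₂ e)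
  adj-sym (inj₂ (refl , inj₂ e)) = inj₂ (refl , inj₁ e)

  adj-down : ∀ {x y} → Adj x y → Adj (down x) (down y)
  adj-down (inj₁ (refl , e))      = inj₁ (refl , e)
  adj-down (inj₂ (refl , inj₁ e)) = inj₂ (refl , inj₁ (cong suc e))
  adj-down (inj₂ (refl , inj₂ e)) = inj₂ (refl , inj₂ (cong suc e))

  path-trans : ∀ {H x y z} → Path H x y → Path H y z → Path H x z
  path-trans here         q = q
  path-trans (step a m p) q = step a m (path-trans p q)

  path-sym : ∀ {H x y} → x ∈ H → Path H x y → Path H y x
  path-sym m here          = here
  path-sym m (step a m′ p) = path-trans (path-sym m′ p) (step (adj-sym a) m here)

  path-down : ∀ {H K x y} → (∀ {z} → z ∈ H → down z ∈ K) → Path H x y → Path K (down x) (down y)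
  path-down f here         = here
  path-down f (step a m p) = step (adj-down a) (f m) (path-down f p)

  path-right : ∀ {H r} c n → (∀ i → i ≤ n → (r , c + i) ∈ H) → Path H (r , c) (r , c + n)
  path-right {H} {r} c zero    f = subst (λ z → Path H (r , c) (r , z)) (sym (ℕ.+-identityʳ c)) here
  path-right {H} {r} c (suc n) f = step (inj₁ (refl , inj₁ refl))
    (subst (λ z → (r , z) ∈ H) (ℕ.+-comm c 1) (f 1 (s≤s z≤n)))
    (subst (λ z → Path H (r , suc c) (r , z)) (sym (ℕ.+-suc c n))
      (path-right (suc c) n λ i i≤n → subst (λ z → (r , z) ∈ H) (ℕ.+-suc c i) (f (suc i) (s≤s i≤n))))

  row-path : ∀ p ps g c → g 0 ≤ c → c ≤ p → g 0 ≤ p → Path (skew (suc p ∷ ps) g) (0 , c) (0 , p)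
  row-path p ps g c g≤c c≤p g≤p = subst (λ z → Path (skew (suc p ∷ ps) g) (0 , c) (0 , z)) (ℕ.m+[n∸m]≡n c≤p)
    (path-right c (p ∸ c) λ i i≤ → ∈-skew⁺ (suc p ∷ ps) g (ℕ.≤-trans g≤c (ℕ.m≤m+n c i))
      (s≤s (ℕ.≤-trans (ℕ.+-monoʳ-≤ c i≤) (ℕ.≤-reflexive (ℕ.m+[n∸m]≡n c≤p)))))

  -- Every node reaches the right end of the first row: by recursion it reaches the right end of the
  -- second row, in column `q`, from where one step up leads to the left end of the hook in the
  -- first row.
  ribbon-hub : ∀ {d p ps qs} → Ribbon d (suc p ∷ ps) qs → ∀ {r c} → (r , c) ∈ skew (suc p ∷ ps) (part qs) →
    Path (skew (suc p ∷ ps) (part qs)) (r , c) (0 , p)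
  ribbon-hub R m = go R refl m
    where
    -- The head `P` is kept apart from `suc p` because `c + suc d` and `q + suc e` do not unify with
    -- `suc p`.
    go : ∀ {d p P ps qs} → Ribbon d (P ∷ ps) qs → P ≡ suc p → ∀ {r c} → (r , c) ∈ skew (suc p ∷ ps) (part qs) →
         Path (skew (suc p ∷ ps) (part qs)) (r , c) (0 , p)
    go {p = p} {ps = ps} (last {c₀}) eq {zero} m with lo , hi ← ∈-skew⁻ (suc p ∷ ps) (part (c₀ ∷ ps)) m =
      row-path p ps (part (c₀ ∷ ps)) _ lo (s≤s⁻¹ hi) (ℕ.≤-trans lo (s≤s⁻¹ hi))
    go {p = p} {ps = ps} (last {c₀}) eq {suc r} m with lo , hi ← ∈-skew⁻ (suc p ∷ ps) (part (c₀ ∷ ps)) m =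
      contradiction hi (ℕ.≤⇒≯ lo)
    go {p = p} {ps = ps} (more {q = q} {ms = ms} R) eq {zero} m with lo , hi ← ∈-skew⁻ (suc p ∷ ps)
        (part (q ∷ ms)) m =
      row-path p ps (part (q ∷ ms)) _ lo (s≤s⁻¹ hi) (ℕ.≤-trans lo (s≤s⁻¹ hi))
    go {p = p} (more {e = e} {q = q} {qs = qs} {ms = ms} R) eq {suc r} {c} m with lo , hi ← ∈-skew⁻
        (suc p ∷ suc q ∷ qs) (part (q ∷ ms)) m =
      path-trans (path-down (λ {z} → ∈-++⁺ʳ _ ∘ ∈-map⁺ down)
          (go R refl (∈-skew⁺ (suc q ∷ qs) (part ms) {r} {c} lo hi)))
        (step (inj₂ (refl , inj₂ refl)) (∈-skew⁺ (suc p ∷ suc q ∷ qs) (part (q ∷ ms)) ℕ.≤-refl (s≤s q≤p))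
          (row-path p (suc q ∷ qs) (part (q ∷ ms)) q ℕ.≤-refl q≤p q≤p))
      where
      q≤p : q ≤ p
      q≤p = s≤s⁻¹ (ℕ.≤-trans (ℕ.≤-trans (s≤s (ℕ.m≤m+n q e)) (ℕ.≤-reflexive (sym (ℕ.+-suc q e)))) (ℕ.≤-reflexive eq))

  ribbon-head : ∀ {d p ps qs} → Ribbon d (p ∷ ps) qs → ∃[ p′ ] p ≡ suc p′
  ribbon-head (last {c} {d})          = c + d , ℕ.+-suc c d
  ribbon-head (more {e = e} {q = q} _) = q + e , ℕ.+-suc q e

  ribbon-connected : ∀ {d ps qs} → Ribbon d ps qs → Connected (skew ps (part qs))
  ribbon-connected {ps = p ∷ ps} R m m′ with _ , refl ← ribbon-head R =
    path-trans (ribbon-hub R m) (path-sym m′ (ribbon-hub R m′))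

  hook-connected : ∀ {d b ps qs} → Hook d b ps qs → Connected (skew ps (part qs))
  hook-connected (start _ R) = ribbon-connected R
  hook-connected {ps = p ∷ ps} {qs = p ∷ qs} (skip h) {zero , c} m _ with lo , hi ← ∈-skew⁻ (p ∷ ps)
      (part (p ∷ qs)) m = contradiction hi (ℕ.≤⇒≯ lo)
  hook-connected {ps = p ∷ ps} {qs = p ∷ qs} (skip h) {suc r , c} {zero , c′} _ m with lo , hi ← ∈-skew⁻
      (p ∷ ps) (part (p ∷ qs)) m = contradiction hi (ℕ.≤⇒≯ lo)
  hook-connected {ps = p ∷ ps} {qs = p ∷ qs} (skip h) {suc r , c} {suc r′ , c′} m m′
    with lo , hi ← ∈-skew⁻ (p ∷ ps) (part (p ∷ qs)) m with lo′ , hi′ ← ∈-skew⁻ (p ∷ ps) (part (p ∷ qs)) m′ =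
    path-down (∈-++⁺ʳ _ ∘ ∈-map⁺ down)
        (hook-connected h (∈-skew⁺ ps (part qs) {r} {c} lo hi) (∈-skew⁺ ps (part qs) {r′} {c′} lo′ hi′))

-- Ribbons and rim hook removals agree

module HookRemoval where

  open import Data.Nat using (_+_; _∸_; _<_; _≤_; _≥_)
  open Ribbons

  open DecMembership (≡-dec ℕ._≟_ ℕ._≟_) using (_∈?_)

  part-zero : ∀ {ps} → WD (0 ∷ ps) → ∀ r → part ps r ≡ 0
  part-zero [-]         r       = refl
  part-zero (z≤n ∷ w)   zero    = refl
  part-zero (z≤n ∷ w)   (suc r) = part-zero w r

  strip : List ℕ → List ℕ
  strip []           = []
  strip (zero ∷ ps)  = []
  strip (suc p ∷ ps) = suc p ∷ strip ps

  part-strip : ∀ {ps} → WD ps → part (strip ps) ≗ part ps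
  part-strip {[]}         w r       = refl
  part-strip {zero ∷ ps}  w zero    = refl
  part-strip {zero ∷ ps}  w (suc r) = sym (part-zero w r)
  part-strip {suc p ∷ ps} w zero    = refl
  part-strip {suc p ∷ ps} w (suc r) = part-strip (Linked.tail w) r

  size-zero : ∀ {ps} → WD (0 ∷ ps) → size ps ≡ 0
  size-zero [-]       = refl
  size-zero (z≤n ∷ w) = size-zero w

  size-strip : ∀ {ps} → WD ps → size (strip ps) ≡ size ps
  size-strip {[]}         w = refl
  size-strip {zero ∷ ps}  w = sym (size-zero w)
  size-strip {suc p ∷ ps} w = cong (λ z → suc p + z) (size-strip (Linked.tail w))

  strip-partition : ∀ {ps} → WD ps → IsPartition (strip ps)
  strip-partition {[]}         w = [] , []
  strip-partition {zero ∷ ps}  w = [] , []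
  strip-partition {suc p ∷ ps} w with w′ , pos ← strip-partition (Linked.tail w) =
    wd-∷ (subst (_≤ suc p) (sym (part-strip (Linked.tail w) 0)) (part-≤-head w)) w′ , s≤s z≤n ∷ pos

  hook⇒removes : ∀ {d b ps qs λ′ μ} → Hook d b ps qs → WD qs → IsPartition μ →
    part λ′ ≗ part ps → part μ ≗ part qs → RemovesHook d λ′ μ
  hook⇒removes {d} {b} {ps} {qs} {λ′} {μ} h w μ-part eqλ eqμ =
    μ-part , skew ps (part qs) , skew-unique ps (part qs) , hook-length h , All.tabulate rim ,
        hook-connected h , λ x → into x , out x
    where
    rim : ∀ {x} → x ∈ skew ps (part qs) → IsRimNode λ′ x
    rim {r , c} m with lo , hi ← ∈-skew⁻ ps (part qs) m rewrite eqλ r | eqλ (suc r) =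
      hi , λ lt → ℕ.<⇒≱ lt (ℕ.≤-trans (hook-rim h w r (ℕ.≤-<-trans lo hi)) (s≤s lo))
    into : ∀ x → x ∈ᴰ μ → x ∈ᴰ λ′ × x ∉ skew ps (part qs)
    into (r , c) lt rewrite eqλ r | eqμ r =
      ℕ.<-≤-trans lt (hook-⊆ h r) , λ m → ℕ.<⇒≱ lt (proj₁ (∈-skew⁻ ps (part qs) m))
    out : ∀ x → x ∈ᴰ λ′ × x ∉ skew ps (part qs) → x ∈ᴰ μ
    out (r , c) (lt , ∉H) rewrite eqλ r | eqμ r = ℕ.≰⇒> λ le → ∉H (∈-skew⁺ ps (part qs) le lt)

  -- Row-wise form of a connected piece of rim: `overlaps` encodes that, between two cut rows,
  -- consecutive rows share a column of the removed set.
  record RibbonShape (ps : List ℕ) (g : ℕ → ℕ) : Set where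
    field
      ⊆-part   : ∀ r → g r ≤ part ps r
      antitone : ∀ r → g (suc r) ≤ g r
      on-rim   : ∀ r → g r < part ps r → part ps (suc r) ≤ suc (g r)
      overlaps : ∀ {a m b} → a ≤ m → m < b → g a < part ps a → g b < part ps b → g m < part ps (suc m)

  open RibbonShape

  shape-tail : ∀ {p ps g} → RibbonShape (p ∷ ps) g → RibbonShape ps (g ∘ suc)
  shape-tail S = record
    { ⊆-part   = λ r → ⊆-part S (suc r)
    ; antitone = λ r → antitone S (suc r)
    ; on-rim   = λ r → on-rim S (suc r)
    ; overlaps = λ a≤m m<b → overlaps S (s≤s a≤m) (s≤s m<b)
    }

  part-∷ : ∀ {ps} {g : ℕ → ℕ} → (∀ r → part ps r ≡ g (suc r)) → part (g 0 ∷ ps) ≗ g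
  part-∷ eq zero    = refl
  part-∷ eq (suc r) = eq r

  -- If the second row is cut as well, the rim condition bounds its part above by `suc (g 0)` and
  -- the overlap bounds it below by the same number, which is the form required by `more`.
  shape⇒ribbon : ∀ p ps g → RibbonShape (p ∷ ps) g → g 0 < p →
    ∃[ d ] ∃[ qs ] (Ribbon d (p ∷ ps) qs × part qs ≗ g)
  shape⇒ribbon p ps g S lt with e , refl ← ℕ.m≤n⇒∃[o]m+o≡n lt = go ps S
    where
    p₀ : suc (g 0) + e ≡ g 0 + suc e
    p₀ = sym (ℕ.+-suc (g 0) e)
    go : ∀ ps → RibbonShape (suc (g 0) + e ∷ ps) g → ∃[ d ] ∃[ qs ] (Ribbon d (suc (g 0) + e ∷ ps) qs × part qs ≗ g)
    go [] S = _ , _ , subst (λ z → Ribbon (suc e) (z ∷ []) (g 0 ∷ [])) (sym p₀) last ,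
      part-∷ λ r → sym (ℕ.n≤0⇒n≡0 (⊆-part S (suc r)))
    go (p′ ∷ ps) S with g 1 ℕ.<? p′
    ... | yes lt′
      with refl ← ℕ.≤-antisym (on-rim S 0 (ℕ.m≤m+n (suc (g 0)) e))
          (overlaps S z≤n (s≤s z≤n) (ℕ.m≤m+n (suc (g 0)) e) lt′)
      with d , ms , R , eq ← shape⇒ribbon p′ ps (g ∘ suc) (shape-tail S) lt′ =
      suc e + d , g 0 ∷ ms , subst (λ z → Ribbon (suc e + d) (z ∷ p′ ∷ ps) (g 0 ∷ ms)) (sym p₀) (more R) , part-∷ eq
    ... | no ≮ = _ , _ , subst (λ z → Ribbon (suc e) (z ∷ p′ ∷ ps) (g 0 ∷ p′ ∷ ps)) (sym p₀) last , part-∷ rest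
      where
      -- A cut further down would force rows 0 and 1 to overlap, and then row 1 would be cut after
      -- all.
      rest : ∀ r → part (p′ ∷ ps) r ≡ g (suc r)
      rest r = ℕ.≤-antisym (ℕ.≮⇒≥ λ lt′ → ≮ (ℕ.≤-<-trans (antitone S 0)
        (overlaps S z≤n (s≤s z≤n) (ℕ.m≤m+n (suc (g 0)) e) lt′))) (⊆-part S (suc r))

  i-j+j≡i : ∀ i j → i ℤ.- j ℤ.+ j ≡ i
  i-j+j≡i = solve-∀

  shape⇒hook : ∀ ps g → RibbonShape ps g → ∀ r → g r < part ps r → ∃[ d ] ∃[ b ] ∃[ qs ]
      (Hook d b ps qs × part qs ≗ g)
  shape⇒hook (p ∷ ps) g S r lt with g 0 ℕ.<? p
  ... | yes lt₀ with d , qs , R , eq ← shape⇒ribbon p ps g S lt₀ = d , + p ℤ.- + d , qs , start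
      (i-j+j≡i (+ p) (+ d)) R , eq
  shape⇒hook (p ∷ ps) g S zero    lt | no ≮ = contradiction lt ≮
  shape⇒hook (p ∷ ps) g S (suc r) lt | no ≮
    with refl ← ℕ.≤-antisym (⊆-part S 0) (ℕ.≮⇒≥ ≮)
    with d , b , qs , h , eq ← shape⇒hook ps (g ∘ suc) (shape-tail S) r lt =
    d , ℤ.pred b , _ , skip (subst (λ z → Hook d z ps qs) (sym (ℤ.suc-pred b)) h) , part-∷ eq

  -- Each step changes the row by at most one, so a path cannot pass `m` without a vertical step
  -- from `m` to `suc m`.
  path-crosses : ∀ {H x y m} → x ∈ H → Path H x y → proj₁ x ≤ m → m < proj₁ y →
    ∃[ c ] ((m , c) ∈ H × (suc m , c) ∈ H)
  path-crosses x∈ here lo hi = contradiction hi (ℕ.≤⇒≯ lo)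
  path-crosses {m = m} x∈ (step {z = r′ , c′} a z∈ p) lo hi with r′ ℕ.≤? m
  ... | yes r′≤m = path-crosses z∈ p r′≤m hi
  path-crosses x∈ (step (inj₁ (refl , _)) z∈ p) lo hi | no ≰ = contradiction lo ≰
  path-crosses x∈ (step (inj₂ (refl , inj₂ refl)) z∈ p) lo hi | no ≰ = contradiction (ℕ.<⇒≤ lo) ≰
  path-crosses x∈ (step (inj₂ (refl , inj₁ refl)) z∈ p) lo hi | no ≰
    with refl ← ℕ.≤-antisym lo (s≤s⁻¹ (ℕ.≰⇒> ≰)) = _ , x∈ , z∈

  unique-set-length : ∀ {H K : List Node} → Unique H → Unique K →
    (∀ {x} → x ∈ H → x ∈ K) → (∀ {x} → x ∈ K → x ∈ H) → length H ≡ length K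
  unique-set-length u v f g = ↭-length (∼bag⇒↭ (unique∧set⇒bag u v (mk⇔ f g)))

  -- Connectedness and the rim condition give the shape. The length of the resulting hook is then
  -- found by counting: `H` and the skew diagram are duplicate-free lists of the same nodes.
  removes⇒hook : ∀ {d λ′ μ} → RemovesHook (suc d) λ′ μ → ∃[ b ] ∃[ qs ] (Hook (suc d) b λ′ qs × part qs ≗ part μ)
  removes⇒hook {d} {λ′} {μ} ((μ-wd , _) , H , H-unique , H-length , H-rim , H-conn , H-diff) = result
    where
    ∈H : ∀ {r c} → part μ r ≤ c → c < part λ′ r → (r , c) ∈ H
    ∈H {r} {c} lo hi with (r , c) ∈? H
    ... | yes m = m
    ... | no ∉H = contradiction (proj₂ (H-diff (r , c)) (hi , ∉H)) (ℕ.≤⇒≯ lo)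
    H∈ : ∀ {r c} → (r , c) ∈ H → part μ r ≤ c × c < part λ′ r
    H∈ {r} {c} m = ℕ.≮⇒≥ (λ lt → proj₂ (proj₁ (H-diff (r , c)) lt) m) , proj₁ (All.lookup H-rim m)
    ⊆ : ∀ r → part μ r ≤ part λ′ r
    ⊆ r = ℕ.≮⇒≥ λ lt → ℕ.<-irrefl refl (proj₁ (proj₁ (H-diff (r , part λ′ r)) lt))
    overlaps′ : ∀ {a m b} → a ≤ m → m < b → part μ a < part λ′ a → part μ b < part λ′ b → part μ m < part λ′ (suc m)
    overlaps′ a≤m m<b lt lt′
      with c , m₁ , m₂ ← path-crosses (∈H ℕ.≤-refl lt) (H-conn (∈H ℕ.≤-refl lt) (∈H ℕ.≤-refl lt′)) a≤m m<b =
      ℕ.≤-<-trans (proj₁ (H∈ m₁)) (proj₂ (H∈ m₂))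
    shape : RibbonShape λ′ (part μ)
    shape = record
      { ⊆-part   = ⊆
      ; antitone = part-antitone μ-wd
      ; on-rim   = λ r lt → ℕ.≮⇒≥ (proj₂ (All.lookup H-rim (∈H ℕ.≤-refl lt)))
      ; overlaps = overlaps′
      }
    node : ∀ {K : List Node} → length K ≡ suc d → ∃[ x ] x ∈ K
    node {x ∷ _} _ = x , here refl
    result : ∃[ b ] ∃[ qs ] (Hook (suc d) b λ′ qs × part qs ≗ part μ)
    result with (r , c) , m ← node H-length
      with lo , hi ← H∈ m
      with d′ , b , qs , h , eq ← shape⇒hook λ′ (part μ) shape r (ℕ.≤-<-trans lo hi)
      = b , qs , subst (λ z → Hook z b λ′ qs) d′≡ h , eq
      where
      d′≡ : d′ ≡ suc d
      d′≡ = trans (sym (hook-length h)) (trans (unique-set-length (skew-unique λ′ (part qs)) H-unique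
        (λ { {r , c} m → let (lo , hi) = ∈-skew⁻ λ′ (part qs) m in ∈H (subst (_≤ c) (eq r) lo) hi })
        (λ { {r , c} m → let (lo , hi) = H∈ m in ∈-skew⁺ λ′ (part qs) (subst (_≤ c) (sym (eq r)) lo) hi })) H-length)

-- Bead sequences and hook moves

module Beads where

  open import Data.Integer using (_+_; _-_; -_; _<_; _≤_; _≤?_)
  open Ribbons
  open HookRemoval

  eqᵇ : ℤ → ℤ → Bool
  eqᵇ x y = ⌊ x ℤ.≟ y ⌋

  -- The bead of row r (counted from 0) sits at position part λ r - r.
  χ : List ℕ → ℤ → Bool
  χ []       x = ⌊ x ≤? 0ℤ ⌋
  χ (p ∷ ps) x = eqᵇ x (+ p) ∨ χ ps (ℤ.suc x)

  eqᵇ-refl : ∀ {x y} → x ≡ y → eqᵇ x y ≡ true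
  eqᵇ-refl {x} {y} eq with x ℤ.≟ y
  ... | yes _ = refl
  ... | no ≢  = contradiction eq ≢

  eqᵇ-≢ : ∀ {x y} → x ≢ y → eqᵇ x y ≡ false
  eqᵇ-≢ {x} {y} ≢ with x ℤ.≟ y
  ... | yes eq = contradiction eq ≢
  ... | no _   = refl

  suc-injective : ∀ {x y} → ℤ.suc x ≡ ℤ.suc y → x ≡ y
  suc-injective {x} {y} eq = trans (sym (ℤ.pred-suc x)) (trans (cong ℤ.pred eq) (ℤ.pred-suc y))

  eqᵇ-suc : ∀ x y → eqᵇ (ℤ.suc x) (ℤ.suc y) ≡ eqᵇ x y
  eqᵇ-suc x y with x ℤ.≟ y
  ... | yes eq = eqᵇ-refl (cong ℤ.suc eq)
  ... | no ≢   = eqᵇ-≢ (≢ ∘ suc-injective)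

  χ-there : ∀ {p} ps {x} → x ≢ + p → χ (p ∷ ps) x ≡ χ ps (ℤ.suc x)
  χ-there ps {x} ≢ = cong (_∨ χ ps (ℤ.suc x)) (eqᵇ-≢ ≢)

  χ-here : ∀ {p} ps {x} → x ≡ + p → χ (p ∷ ps) x ≡ true
  χ-here ps {x} eq = cong (_∨ χ ps (ℤ.suc x)) (eqᵇ-refl eq)

  χ-[]-true : ∀ {x} → x ≤ 0ℤ → χ [] x ≡ true
  χ-[]-true {x} h with x ≤? 0ℤ
  ... | yes _ = refl
  ... | no ≰  = contradiction h ≰

  χ-[]-false : ∀ {x} → 0ℤ < x → χ [] x ≡ false
  χ-[]-false {x} h with x ≤? 0ℤ
  ... | yes le = contradiction h (ℤ.≤⇒≯ le)
  ... | no _   = refl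

  χ-[]-false⁻¹ : ∀ {x} → χ [] x ≡ false → 0ℤ < x
  χ-[]-false⁻¹ {x} eq with x ≤? 0ℤ
  ... | no ≰  = ℤ.≰⇒> ≰

  χ-[]-true⁻¹ : ∀ {x} → χ [] x ≡ true → x ≤ 0ℤ
  χ-[]-true⁻¹ {x} eq with x ≤? 0ℤ
  ... | yes le = le

  x<suc : ∀ x → x < ℤ.suc x
  x<suc x = ℤ.suc[i]≤j⇒i<j ℤ.≤-refl

  χ-above : ∀ {ps x} → WD ps → + part ps 0 < x → χ ps x ≡ false
  χ-above {[]}     w h = χ-[]-false h
  χ-above {p ∷ ps} {x} w h = trans (χ-there ps (λ eq → ℤ.<-irrefl (sym eq) h))
    (χ-above (Linked.tail w) (ℤ.≤-<-trans (+≤+ (part-≤-head w)) (ℤ.<-trans h (x<suc x))))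

  χ-true⇒≤ : ∀ {ps x} → WD ps → χ ps x ≡ true → x ≤ + part ps 0
  χ-true⇒≤ {ps} {x} w eq = ℤ.≮⇒≥ λ lt → contradiction (trans (sym eq) (χ-above w lt)) λ ()

  χ-below : ∀ ps {x} → x + + length ps ≤ 0ℤ → χ ps x ≡ true
  χ-below [] {x} h = χ-[]-true (subst (_≤ 0ℤ) (ℤ.+-identityʳ x) h)
  χ-below (p ∷ ps) {x} h = trans (cong (eqᵇ x (+ p) ∨_) (χ-below ps (subst (_≤ 0ℤ) (lemma x (+ length ps)) h)))
      (Bool.∨-zeroʳ _)
    where
    lemma : ∀ x y → x + (1ℤ + y) ≡ 1ℤ + x + y
    lemma = solve-∀

  -- The empty list stands for infinitely many empty rows, and splitting off one of them changes no
  -- bead. This lets `χ-cong` compare lists of different lengths.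
  χ-[]-step : ∀ x → χ [] x ≡ χ (0 ∷ []) x
  χ-[]-step x with x ℤ.≟ 0ℤ
  ... | yes refl = refl
  ... | no ≢ with x ≤? 0ℤ
  ...   | yes le = sym (χ-[]-true (ℤ.i<j⇒suc[i]≤j (ℤ.≤∧≢⇒< le ≢)))
  ...   | no ≰   = sym (χ-[]-false (ℤ.<-trans (ℤ.≰⇒> ≰) (x<suc x)))

  χ-cong : ∀ ps qs → part ps ≗ part qs → χ ps ≗ χ qs
  χ-cong []       []       eq x = refl
  χ-cong []       (q ∷ qs) eq x rewrite sym (eq 0) =
    trans (χ-[]-step x) (cong (eqᵇ x 0ℤ ∨_) (χ-cong [] qs (eq ∘ suc) (ℤ.suc x)))
  χ-cong (p ∷ ps) []       eq x rewrite eq 0 =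
    trans (cong (eqᵇ x 0ℤ ∨_) (χ-cong ps [] (eq ∘ suc) (ℤ.suc x))) (sym (χ-[]-step x))
  χ-cong (p ∷ ps) (q ∷ qs) eq x =
    cong₂ _∨_ (cong (eqᵇ x ∘ +_) (eq 0)) (χ-cong ps qs (eq ∘ suc) (ℤ.suc x))

  abstract
    χ-injective : ∀ {ps qs} → IsPartition ps → IsPartition qs → χ ps ≗ χ qs → ps ≡ qs
    χ-injective {[]} {[]} _ _ eq = refl
    χ-injective {[]} {q ∷ qs} _ (_ , pos ∷ _) eq =
      contradiction (trans (sym (χ-here qs refl)) (trans (sym (eq (+ q))) (χ-[]-false (+<+ pos)))) λ ()
    χ-injective {p ∷ ps} {[]} (_ , pos ∷ _) _ eq =
      contradiction (trans (sym (χ-here ps refl)) (trans (eq (+ p)) (χ-[]-false (+<+ pos)))) λ ()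
    χ-injective {p ∷ ps} {q ∷ qs} (w , _ ∷ pos) (w′ , _ ∷ pos′) eq
      with refl ← ℕ.≤-antisym (ℤ.drop‿+≤+ (χ-true⇒≤ w′ (trans (sym (eq (+ p))) (χ-here ps refl))))
                              (ℤ.drop‿+≤+ (χ-true⇒≤ w (trans (eq (+ q)) (χ-here qs refl)))) =
      cong (p ∷_) (χ-injective (Linked.tail w , pos) (Linked.tail w′ , pos′) eq′)
      where
      eq′ : χ ps ≗ χ qs
      eq′ x with ℤ.pred x ℤ.≟ + p
      ... | no ≢ = subst (λ z → χ ps z ≡ χ qs z) (ℤ.suc-pred x)
                     (trans (sym (χ-there ps ≢)) (trans (eq (ℤ.pred x)) (χ-there qs ≢)))
      -- The head bead hides the bit of the tail here, but in both tails the first bead lies below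
      -- `x`.
      ... | yes e = trans (χ-above (Linked.tail w) (lt w)) (sym (χ-above (Linked.tail w′) (lt w′)))
        where
        lt : ∀ {rs} → WD (p ∷ rs) → + part rs 0 < x
        lt v = ℤ.≤-<-trans (+≤+ (part-≤-head v))
            (subst (_< x) e (subst (ℤ.pred x <_) (ℤ.suc-pred x) (x<suc (ℤ.pred x))))

  record Moved (f : ℤ → Bool) (b c : ℤ) (g : ℤ → Bool) : Set where
    constructor moved
    field
      from-c : f c ≡ true
      from-b : f b ≡ false
      to-b   : g b ≡ true
      to-c   : g c ≡ false
      same   : ∀ x → x ≢ b → x ≢ c → g x ≡ f x

  b<b+d : ∀ b d → b < b + + suc d
  b<b+d b d = subst (_< b + + suc d) (ℤ.+-identityʳ b) (ℤ.+-monoʳ-< b (+<+ (s≤s z≤n)))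

  b≢b+d : ∀ b d → b ≢ b + + suc d
  b≢b+d b d eq = ℤ.<-irrefl eq (b<b+d b d)

  suc-+ : ∀ b d → ℤ.suc (b + d) ≡ ℤ.suc b + d
  suc-+ b d = sym (ℤ.+-assoc 1ℤ b d)

  ribbon-pos : ∀ {d ps qs} → Ribbon d ps qs → ∃[ d′ ] d ≡ suc d′
  ribbon-pos last     = _ , refl
  ribbon-pos (more _) = _ , refl

  more-pos : ∀ {b e d q} → b + + (suc e ℕ.+ d) ≡ + (q ℕ.+ suc e) → b + + d ≡ + q
  more-pos {b} {e} {d} {q} eq = +-cancelʳ (+ suc e) _ _ (trans (lemma b (+ d) (+ suc e)) eq)
    where
    lemma : ∀ b d e → b + d + e ≡ b + (e + d)
    lemma = solve-∀

  -- A part `suc q` one row further down has its bead where a part `q` would have it. So in `more`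
  -- the beads passed over keep their positions, and only the head bead is replaced by one at `b`.
  ribbon-χ : ∀ {d p ps qs b} → Ribbon d (p ∷ ps) qs → b + + d ≡ + p →
    ∀ x → χ qs x ≡ eqᵇ x b ∨ χ ps (ℤ.suc x)
  ribbon-χ {b = b} (last {c} {d} {ps}) eq x with refl ← +-cancelʳ (+ suc d) b (+ c) eq = refl
  ribbon-χ {b = b} (more {d} {e} {q} {qs} {ms} R) eq x = begin
    eqᵇ x (+ q) ∨ χ ms (ℤ.suc x)                                    ≡⟨ cong (eqᵇ x (+ q) ∨_)
        (ribbon-χ R (trans (sym (suc-+ b (+ d))) (cong ℤ.suc b+d≡q)) (ℤ.suc x)) ⟩
    eqᵇ x (+ q) ∨ (eqᵇ (ℤ.suc x) (ℤ.suc b) ∨ Z)                     ≡⟨ cong₂ (λ u v → u ∨ (v ∨ Z))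
        (sym (eqᵇ-suc x (+ q))) (eqᵇ-suc x b) ⟩
    eqᵇ (ℤ.suc x) (+ suc q) ∨ (eqᵇ x b ∨ Z)                         ≡⟨ swap-∨ (eqᵇ (ℤ.suc x) (+ suc q)) (eqᵇ x b) Z ⟩
    eqᵇ x b ∨ (eqᵇ (ℤ.suc x) (+ suc q) ∨ Z)                         ∎
    where
    open ≡-Reasoning
    Z = χ qs (ℤ.suc (ℤ.suc x))
    b+d≡q : b + + d ≡ + q
    b+d≡q = more-pos {b} {e} {d} {q} eq
    swap-∨ : ∀ u v w → u ∨ (v ∨ w) ≡ v ∨ (u ∨ w)
    swap-∨ true  true  w = refl
    swap-∨ true  false w = refl
    swap-∨ false v     w = refl

  -- The beads passed over lie strictly above `b`. In the last row of the ribbon the new part sits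
  -- at `b`, and weak decrease of the new list puts all later beads strictly below it.
  ribbon-gap : ∀ {d p ps qs b} → Ribbon d (p ∷ ps) qs → WD qs → b + + d ≡ + p → χ ps (ℤ.suc b) ≡ false
  ribbon-gap {b = b} (last {c} {d} {ps}) w eq with refl ← +-cancelʳ (+ suc d) b (+ c) eq =
    χ-above (Linked.tail w) (+<+ (s≤s (part-≤-head w)))
  ribbon-gap {b = b} (more {d} {e} {q} {qs} {ms} R) w eq with d′ , refl ← ribbon-pos R =
    trans (χ-there qs λ e′ → b≢b+d b d′ (trans (suc-injective {b} {+ q} e′) (sym b+d≡q)))
      (ribbon-gap {b = ℤ.suc b} R (Linked.tail w) (trans (sym (suc-+ b (+ d))) (cong ℤ.suc b+d≡q)))
    where
    b+d≡q : b + + d ≡ + q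
    b+d≡q = more-pos {b} {e} {d} {q} eq

  abstract
    hook-χ : ∀ {d b ps qs} → Hook d b ps qs → WD ps → WD qs → Moved (χ ps) b (b + + d) (χ qs)
    hook-χ {d} {b} {p ∷ ps} {qs} (start eq R) w w′ with d′ , refl ← ribbon-pos R = record
      { from-c = χ-here ps eq
      ; from-b = trans (χ-there ps (λ e → b≢b+d b d′ (trans e (sym eq)))) (ribbon-gap {b = b} R w′ eq)
      ; to-b   = trans (ribbon-χ R eq b) (cong (_∨ χ ps (ℤ.suc b)) (eqᵇ-refl {b} refl))
      ; to-c   = trans (ribbon-χ R eq (b + + d)) (trans (cong (_∨ χ ps (ℤ.suc (b + + d))) (eqᵇ-≢ (b≢b+d b d′ ∘ sym)))
                   (χ-above (Linked.tail w)
                       (ℤ.≤-<-trans (+≤+ (part-≤-head w)) (subst (+ p <_) (cong ℤ.suc (sym eq)) (x<suc (+ p))))))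
      ; same   = λ x x≢b x≢c → trans (ribbon-χ R eq x)
            (trans (cong (_∨ χ ps (ℤ.suc x)) (eqᵇ-≢ x≢b)) (sym (χ-there ps (λ e → x≢c (trans e (sym eq))))))
      }
    hook-χ {d} {b} {p ∷ ps} {p ∷ qs} (skip h) w w′
      with moved c₁ b₁ b₂ c₂ same ← hook-χ h (Linked.tail w) (Linked.tail w′) = record
      { from-c = trans (χ-there ps c≢p) (trans (cong (χ ps) (suc-+ b (+ d))) c₁)
      ; from-b = trans (χ-there ps b≢p) b₁
      ; to-b   = trans (χ-there qs b≢p) b₂
      ; to-c   = trans (χ-there qs c≢p) (trans (cong (χ qs) (suc-+ b (+ d))) c₂)
      ; same   = λ x x≢b x≢c → cong (eqᵇ x (+ p) ∨_)
                   (same (ℤ.suc x) (x≢b ∘ suc-injective)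
                       (x≢c ∘ suc-injective ∘ (λ e → trans e (sym (suc-+ b (+ d))))))
      }
      where
      -- The moving bead belongs to a later row, so it lies strictly below the bead of the skipped
      -- row.
      c≤p : ℤ.suc (b + + d) ≤ + p
      c≤p = ℤ.≤-trans (χ-true⇒≤ (Linked.tail w) (trans (cong (χ ps) (suc-+ b (+ d))) c₁)) (+≤+ (part-≤-head w))
      c<p : b + + d < + p
      c<p = ℤ.suc[i]≤j⇒i<j c≤p
      c≢p : b + + d ≢ + p
      c≢p e = ℤ.<-irrefl e c<p
      b≢p : b ≢ + p
      b≢p e = ℤ.<-irrefl e (ℤ.≤-<-trans (ℤ.i≤i+j b (+ d)) c<p)

  ribbon-head< : ∀ {d p ps qs} → Ribbon d (p ∷ ps) qs → part qs 0 ℕ.< p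
  ribbon-head< (last {c} {d})      = ℕ.m<m+n c (s≤s z≤n)
  ribbon-head< (more {q = q} _)    = ℕ.m<m+n q (s≤s z≤n)

  pos-diff : ∀ {x y} → x < y → ∃[ d ] x + + suc d ≡ y
  pos-diff {x} {y} lt with y - ℤ.suc x in eq | ℤ.i≤j⇒0≤j-i (ℤ.i<j⇒suc[i]≤j lt)
  ... | + d | _ = d , trans (cong (λ z → x + (1ℤ + z)) (sym eq)) (lemma x y)
    where
    lemma : ∀ x y → x + (1ℤ + (y - (1ℤ + x))) ≡ y
    lemma = solve-∀

  -- The ribbon takes in every row whose bead lies between `b` and the moving bead. The bead of the
  -- next row `q` is at q - 1, so `+ q ≤ b` says that it is below `b` and the ribbon ends; q - 1 = b
  -- is excluded because `b` is free.
  bits⇒ribbon : ∀ d p ps b → WD (p ∷ ps) → b + + suc d ≡ + p → χ ps (ℤ.suc b) ≡ false →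
    ∃[ qs ] (Ribbon (suc d) (p ∷ ps) qs × WD qs)
  bits⇒ribbon-last : ∀ d p ps c → WD (c ∷ ps) → + c + + suc d ≡ + p →
    ∃[ qs ] (Ribbon (suc d) (p ∷ ps) qs × WD qs)
  bits⇒ribbon-last d p ps c w eq with refl ← ℤ.+-injective eq = c ∷ ps , last , w

  bits⇒ribbon d p [] (+ c) w eq f = bits⇒ribbon-last d p [] c [-] eq
  bits⇒ribbon d p [] -[1+ n ] w eq f = contradiction
      (trans (sym f) (χ-[]-true (subst (_≤ 0ℤ) (sym (ℤ.1-[1+n]≡-n n)) ℤ.neg-≤-pos))) λ ()
  bits⇒ribbon d p (q ∷ qs) b w eq f with + q ≤? b
  bits⇒ribbon d p (q ∷ qs) (+ c) w eq f | yes (+≤+ q≤c) = bits⇒ribbon-last d p (q ∷ qs) c (q≤c ∷ Linked.tail w) eq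
  bits⇒ribbon d p (q ∷ qs) b w eq f | no ≰
    with suc-b≢q ← (λ e → contradiction (trans (sym f) (χ-here qs e)) λ ())
    with d′ , eq′ ← pos-diff (ℤ.≤∧≢⇒< (ℤ.i<j⇒suc[i]≤j (ℤ.≰⇒> ≰)) suc-b≢q)
    with ms , R , w′ ← bits⇒ribbon d′ q qs (ℤ.suc b) (Linked.tail w) eq′ (trans (sym (χ-there qs suc-b≢q)) f)
    with q′ , refl ← ribbon-head R
    with e , refl ← ℕ.m≤n⇒∃[o]m+o≡n (part-≤-head w) =
    q′ ∷ ms , subst₂ (λ u v → Ribbon u (v ∷ suc q′ ∷ qs) (q′ ∷ ms)) d-eq (ℕ.+-suc q′ e) (more R) , wd-∷
        (s≤s⁻¹ (ribbon-head< R)) w′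
    where
    lemma₁ : ∀ b d e → e + d ≡ (b + d) + e - b
    lemma₁ = solve-∀
    lemma₂ : ∀ b d → d ≡ b + d - b
    lemma₂ = solve-∀
    d-eq : suc e ℕ.+ suc d′ ≡ suc d
    d-eq = ℤ.+-injective
        (trans (lemma₁ b (+ suc d′) (+ suc e))
        (trans (cong (_- b) (trans
        (cong (_+ + suc e) (suc-injective {b + + suc d′} {+ q′} (trans (suc-+ b (+ suc d′)) eq′)))
        (trans (cong +_ (ℕ.+-suc q′ e)) (sym eq)))) (sym (lemma₂ b (+ suc d)))))

  bits⇒hook : ∀ d ps b → WD ps → χ ps (b + + suc d) ≡ true → χ ps b ≡ false →
    ∃[ qs ] (Hook (suc d) b ps qs × WD qs)
  bits⇒hook d [] b w c₁ b₁ = contradiction (ℤ.<-trans (χ-[]-false⁻¹ {b} b₁) (b<b+d b d)) (ℤ.≤⇒≯ (χ-[]-true⁻¹ c₁))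
  bits⇒hook d (p ∷ ps) b w c₁ b₁ with b ℤ.≟ + p
  ... | yes eq = contradiction b₁ λ ()
  ... | no b≢p with b + + suc d ℤ.≟ + p
  ...   | yes eq with qs , R , w′ ← bits⇒ribbon d p ps b w eq b₁ = qs , start eq R , w′
  ...   | no c≢p with qs , h , w′ ← bits⇒hook d ps (ℤ.suc b) (Linked.tail w)
      (trans (cong (χ ps) (sym (suc-+ b (+ suc d)))) c₁) b₁ =
    p ∷ qs , skip h , wd-∷ (ℕ.≤-trans (hook-⊆ h 0) (part-≤-head w)) w′

  -- Hook additions and the interface between hooks and beads

  infix 4 _∈β_

  data _∈β_ : ℤ → List ℕ → Set where
    here  : ∀ {b p ps} → b ≡ + p → b ∈β (p ∷ ps)
    there : ∀ {b p ps} → ℤ.suc b ∈β ps → b ∈β (p ∷ ps)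

  -- Inverse to a ribbon removal: a row `c` passed on the way up moves one row down and becomes
  -- `suc c`, which leaves its bead in place.
  upRibbon : ∀ {b} D ms → WD ms → b ∈β ms → part ms 0 ℕ.< D →
    ∃[ d ] ∃[ ps ] (Ribbon d (D ∷ ps) ms × b + + d ≡ + D × WD (D ∷ ps))
  upRibbon D (c ∷ ms) w (here refl) lt with e , refl ← ℕ.m≤n⇒∃[o]m+o≡n lt rewrite sym (ℕ.+-suc c e) =
    suc e , ms , last , refl , wd-∷ (ℕ.≤-trans (part-≤-head w) (ℕ.m≤m+n c (suc e))) (Linked.tail w)
  upRibbon {b} D (c ∷ ms) w (there m) lt
    with d , ps , R , eq , w′ ← upRibbon (suc c) ms (Linked.tail w) m (s≤s (part-≤-head w))
    with e , refl ← ℕ.m≤n⇒∃[o]m+o≡n lt rewrite sym (ℕ.+-suc c e) =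
    suc e ℕ.+ d , suc c ∷ ps , more R ,
    trans (lemma b (+ suc e) (+ d)) (cong (_+ + suc e) (suc-injective {b + + d} {+ c} (trans (suc-+ b (+ d)) eq))) ,
    lt ∷ w′
    where
    lemma : ∀ b e d → b + (e + d) ≡ b + d + e
    lemma = solve-∀

  hook-head : ∀ {d b ps qs} → Hook d b ps qs → part ps 0 ≡ part qs 0 ⊎ + part ps 0 ≡ b + + d
  hook-head (start eq _) = inj₂ (sym eq)
  hook-head (skip _)     = inj₁ refl

  upHook : ∀ {b} d ms → WD ms → b ∈β ms → χ ms (b + + suc d) ≡ false →
    ∃[ ps ] (Hook (suc d) b ps ms × WD ps)
  upHook {b} d (c ∷ ms) w m f with ℤ.<-cmp (+ c) (b + + suc d)
  ... | tri≈ _ eq _ = contradiction (trans (sym f) (χ-here ms (sym eq))) λ ()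
  ... | tri< lt _ _ = go refl lt
    where
    go : ∀ {x} → x ≡ b + + suc d → + c < x → ∃[ ps ] (Hook (suc d) b ps (c ∷ ms) × WD ps)
    go {+ D} eq (+<+ c<D) with d′ , ps , R , eq′ , w′ ← upRibbon D (c ∷ ms) w m c<D
      with refl ← ℤ.+-injective (+-cancelˡ b _ _ (trans eq′ eq)) = D ∷ ps , start eq′ R , w′
  upHook {b} d (c ∷ ms) w (here refl) f | tri> _ _ gt = contradiction gt (ℤ.<-asym (b<b+d b d))
  upHook {b} d (c ∷ ms) w (there m) f | tri> _ c≢ gt
    with ps , h , w′ ← upHook d ms (Linked.tail w) m
           (trans (cong (χ ms) (sym (suc-+ b (+ suc d)))) (trans (sym (χ-there ms (c≢ ∘ sym))) f)) =
    c ∷ ps , skip h , wd-∷ (bound (hook-head h)) w′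
    where
    bound : part ps 0 ≡ part ms 0 ⊎ + part ps 0 ≡ ℤ.suc b + + suc d → part ps 0 ℕ.≤ c
    bound (inj₁ eq) = subst (ℕ._≤ c) (sym eq) (part-≤-head w)
    bound (inj₂ eq) = ℤ.drop‿+≤+ (subst (_≤ + c) (trans (suc-+ b (+ suc d)) (sym eq)) (ℤ.i<j⇒suc[i]≤j gt))

  pad : ℕ → List ℕ → List ℕ
  pad k ps = ps ++ replicate k 0

  part-replicate : ∀ k r → part (replicate k 0) r ≡ 0
  part-replicate zero    r       = refl
  part-replicate (suc k) zero    = refl
  part-replicate (suc k) (suc r) = part-replicate k r

  part-pad : ∀ k ps → part ps ≗ part (pad k ps)
  part-pad k []       r       = sym (part-replicate k r)
  part-pad k (p ∷ ps) zero    = refl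
  part-pad k (p ∷ ps) (suc r) = part-pad k ps r

  wd-pad : ∀ k {ps} → WD ps → WD (pad k ps)
  wd-pad zero    {[]}     w = []
  wd-pad (suc k) {[]}     w = wd-∷ (ℕ.≤-reflexive (part-replicate k 0)) (wd-pad k [])
  wd-pad k       {p ∷ ps} w = wd-∷ (subst (ℕ._≤ p) (part-pad k ps 0) (part-≤-head w)) (wd-pad k (Linked.tail w))

  -- The bead at -n of the empty partition belongs to empty row n, counted from 0, so `suc n` zero
  -- rows bring it into the list.
  χ⇒∈β : ∀ ps {b} → χ ps b ≡ true → ∃[ k ] b ∈β pad k ps
  χ⇒∈β [] {b} t = nonpos b (χ-[]-true⁻¹ t)
    where
    neg : ∀ n → - (+ n) ∈β replicate (suc n) 0
    neg zero    = here refl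
    neg (suc n) = there (subst (_∈β replicate (suc n) 0) (sym (ℤ.1-[1+n]≡-n n)) (neg n))
    nonpos : ∀ b → b ≤ 0ℤ → ∃[ k ] b ∈β replicate k 0
    nonpos (+ 0)    _ = 1 , neg 0
    nonpos (+ suc n) (+≤+ ())
    nonpos -[1+ n ] _ = suc (suc n) , neg (suc n)
  χ⇒∈β (p ∷ ps) {b} t with b ℤ.≟ + p
  ... | yes eq = 0 , here eq
  ... | no _ with k , m ← χ⇒∈β ps t = k , there m

  moved-cong : ∀ {f f′ b c g g′} → f ≗ f′ → g ≗ g′ → Moved f b c g → Moved f′ b c g′
  moved-cong {b = b} {c} ef eg (moved c₁ b₁ b₂ c₂ same) = moved
    (trans (sym (ef c)) c₁) (trans (sym (ef b)) b₁) (trans (sym (eg b)) b₂) (trans (sym (eg c)) c₂)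
    λ x x≢b x≢c → trans (sym (eg x)) (trans (same x x≢b x≢c) (ef x))

  abstract
    -- With `move-up`, `removes⇒moved` and `removes-size` this is the whole bridge between hooks and
    -- beads; no node of a diagram is mentioned afterwards.
    move-down : ∀ {d ps b} → IsPartition ps → χ ps (b + + suc d) ≡ true → χ ps b ≡ false →
      ∃[ μ ] (RemovesHook (suc d) ps μ × size ps ≡ size μ ℕ.+ suc d × Moved (χ ps) b (b + + suc d) (χ μ))
    move-down {d} {ps} {b} (w , _) c₁ b₁ with qs , h , w′ ← bits⇒hook d ps b w c₁ b₁ =
      strip qs , hook⇒removes {λ′ = ps} h w′ (strip-partition w′) (λ _ → refl) (part-strip w′) ,
      trans (hook-size h) (cong (ℕ._+ suc d) (sym (size-strip w′))) ,
      moved-cong (λ _ → refl) (χ-cong qs (strip qs) (λ r → sym (part-strip w′ r))) (hook-χ h w w′)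

  abstract
    move-up : ∀ {d ps b} → IsPartition ps → χ ps b ≡ true → χ ps (b + + suc d) ≡ false →
      ∃[ μ ] (IsPartition μ × RemovesHook (suc d) μ ps × Moved (χ μ) b (b + + suc d) (χ ps))
    move-up {d} {ps} {b} part@(w , _) b₁ c₁ with k , m ← χ⇒∈β ps b₁
      with w′ ← wd-pad k w
      with qs , h , v ← upHook d (pad k ps) w′ m
          (trans (sym (χ-cong ps (pad k ps) (part-pad k ps) (b + + suc d))) c₁) =
      strip qs , strip-partition v , hook⇒removes {λ′ = strip qs} h w′ part (part-strip v) (part-pad k ps) ,
      moved-cong (χ-cong qs (strip qs) (λ r → sym (part-strip v r)))
          (χ-cong (pad k ps) ps λ r → sym (part-pad k ps r)) (hook-χ h v w′)

  abstract
    removes⇒moved : ∀ {d λ′ μ} → IsPartition λ′ → RemovesHook (suc d) λ′ μ → ∃[ b ] Moved (χ λ′) b (b + + suc d) (χ μ)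
    removes⇒moved {d} {λ′} {μ} (w , _) rm@((wμ , _) , _) with b , qs , h , eq ← removes⇒hook rm =
      b , moved-cong (λ _ → refl) (χ-cong qs μ eq) (hook-χ h w (wd-part eq wμ))
      where
      wd-part : ∀ {qs} → part qs ≗ part μ → WD μ → WD qs
      wd-part eq wμ = wd-antitone λ r → subst₂ ℕ._≤_ (sym (eq (suc r))) (sym (eq r)) (part-antitone wμ r)
        where
        wd-antitone : ∀ {qs} → (∀ r → part qs (suc r) ℕ.≤ part qs r) → WD qs
        wd-antitone {[]}     h = []
        wd-antitone {q ∷ qs} h = wd-∷ (h 0) (wd-antitone (h ∘ suc))

  moved-unique : ∀ {f b c g g′} → Moved f b c g → Moved f b c g′ → g ≗ g′
  moved-unique {b = b} {c} (moved _ _ b₂ c₂ s) (moved _ _ b₂′ c₂′ s′) x with x ℤ.≟ b | x ℤ.≟ c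
  ... | yes refl | _        = trans b₂ (sym b₂′)
  ... | no _     | yes refl = trans c₂ (sym c₂′)
  ... | no x≢b   | no x≢c   = trans (s x x≢b x≢c) (sym (s′ x x≢b x≢c))

  abstract
    -- The beads determine the partition that is left, so the removal can be compared with the one
    -- built by `move-down`, whose size is known row by row.
    removes-size : ∀ {d λ′ μ} → IsPartition λ′ → RemovesHook (suc d) λ′ μ → size λ′ ≡ size μ ℕ.+ suc d
    removes-size p rm with b , mv ← removes⇒moved p rm
      with ν , rm′ , sz , mv′ ← move-down p (Moved.from-c mv) (Moved.from-b mv)
      with refl ← χ-injective (proj₁ rm) (proj₁ rm′) (moved-unique mv mv′) = sz

-- Uniqueness of cores and exchanges of positions

module Cores where

  open import Data.Integer using (_+_; _-_; -_; _<_; _≤_)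
  open Beads

  transp : ℤ → ℤ → ℤ → ℤ
  transp a c x with x ℤ.≟ a
  ... | yes _ = c
  ... | no _ with x ℤ.≟ c
  ...   | yes _ = a
  ...   | no _  = x

  transp-l : ∀ a c → transp a c a ≡ c
  transp-l a c with a ℤ.≟ a
  ... | yes _ = refl
  ... | no ≢  = contradiction refl ≢

  transp-r : ∀ a c → transp a c c ≡ a
  transp-r a c with c ℤ.≟ a
  ... | yes eq = eq
  ... | no _ with c ℤ.≟ c
  ...   | yes _ = refl
  ...   | no ≢  = contradiction refl ≢

  transp-o : ∀ {a c x} → x ≢ a → x ≢ c → transp a c x ≡ x
  transp-o {a} {c} {x} ≢a ≢c with x ℤ.≟ a
  ... | yes eq = contradiction eq ≢a
  ... | no _ with x ℤ.≟ c
  ...   | yes eq = contradiction eq ≢c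
  ...   | no _  = refl

  transp-conj : (f : ℤ → ℤ) → (∀ {x y} → f x ≡ f y → x ≡ y) → ∀ a c x → f (transp a c x) ≡ transp (f a) (f c) (f x)
  transp-conj f inj a c x with x ℤ.≟ a
  ... | yes refl = sym (transp-l (f a) (f c))
  ... | no ≢a with x ℤ.≟ c
  ...   | yes refl = sym (transp-r (f a) (f c))
  ...   | no ≢c    = sym (transp-o (≢a ∘ inj) (≢c ∘ inj))

  transp-involutive : ∀ a c x → transp a c (transp a c x) ≡ x
  transp-involutive a c x with x ℤ.≟ a
  ... | yes refl = transp-r a c
  ... | no ≢a with x ℤ.≟ c
  ...   | yes refl = transp-l a c
  ...   | no ≢c    = transp-o ≢a ≢c

  involutive⇒injective : {f : ℤ → ℤ} → (∀ x → f (f x) ≡ x) → ∀ {x y} → f x ≡ f y → x ≡ y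
  involutive⇒injective {f} inv {x} {y} eq = trans (sym (inv x)) (trans (cong f eq) (inv y))

  transp-injective : ∀ a c {x y} → transp a c x ≡ transp a c y → x ≡ y
  transp-injective a c = involutive⇒injective (transp-involutive a c)

  moved⇒transp : ∀ {f b c g} → Moved f b c g → g ≗ f ∘ transp b c
  moved⇒transp {b = b} {c} (moved c₁ b₁ b₂ c₂ same) x with x ℤ.≟ b
  ... | yes refl = trans b₂ (sym c₁)
  ... | no ≢b with x ℤ.≟ c
  ...   | yes refl = trans c₂ (sym b₁)
  ...   | no ≢c    = same x ≢b ≢c

  moved⇒transp⁻ : ∀ {f b c g} → Moved f b c g → f ≗ g ∘ transp b c
  moved⇒transp⁻ {f} {b} {c} mv x = trans (cong f (sym (transp-involutive b c x)))
      (sym (moved⇒transp mv (transp b c x)))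

  transp-bits : (f : ℤ → Bool) → ∀ {a c} → f a ≡ f c → f ≗ f ∘ transp a c
  transp-bits f {a} {c} eq x with x ℤ.≟ a
  ... | yes refl = eq
  ... | no ≢b with x ℤ.≟ c
  ...   | yes refl = sym eq
  ...   | no _     = refl

  true≢false : ∀ {f : ℤ → Bool} {x y} → f x ≡ true → f y ≡ false → x ≢ y
  true≢false t f refl with () ← trans (sym t) f

  -- Each move starts at an occupied position and ends at a free one, so two moves with `b ≢ c`
  -- involve four distinct positions and commute.
  diamond : ∀ {d λ′ μ ν} → IsPartition λ′ → RemovesHook (suc d) λ′ μ → RemovesHook (suc d) λ′ ν →
    μ ≡ ν ⊎ (∃[ ρ ] (RemovesHook (suc d) μ ρ × RemovesHook (suc d) ν ρ))
  diamond {d} {λ′} {μ} {ν} p rμ rν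
    with b , mμ@(moved bT bF _ _ sameμ) ← removes⇒moved p rμ
    with c , mν@(moved cT cF _ _ sameν) ← removes⇒moved p rν with b ℤ.≟ c
  ... | yes refl = inj₁ (χ-injective (proj₁ rμ) (proj₁ rν) (moved-unique mμ mν))
  ... | no b≢c = inj₂ (join
      (move-down (proj₁ rμ) (trans (sameμ (c + D) (true≢false cT bF) (b≢c ∘ sym ∘ +-cancelʳ D c b)) cT)
                            (trans (sameμ c (b≢c ∘ sym) (true≢false bT cF ∘ sym)) cF))
      (move-down (proj₁ rν) (trans (sameν (b + D) (true≢false bT cF) (b≢c ∘ +-cancelʳ D b c)) bT)
                            (trans (sameν b b≢c (true≢false cT bF ∘ sym)) bF)))
    where
    D = + suc d
    join : ∃[ ρ ] (RemovesHook (suc d) μ ρ × size μ ≡ size ρ ℕ.+ suc d × Moved (χ μ) c (c + + suc d) (χ ρ)) →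
           ∃[ ρ ] (RemovesHook (suc d) ν ρ × size ν ≡ size ρ ℕ.+ suc d × Moved (χ ν) b (b + + suc d) (χ ρ)) →
           ∃[ ρ ] (RemovesHook (suc d) μ ρ × RemovesHook (suc d) ν ρ)
    join (ρ , r , _ , m) (ρ′ , r′ , _ , m′) = ρ , r , subst (RemovesHook (suc d) ν)
        (χ-injective (proj₁ r′) (proj₁ r) eq) r′
      where
      open ≡-Reasoning
      eq : χ ρ′ ≗ χ ρ
      eq x = begin
        χ ρ′ x                                              ≡⟨ moved⇒transp m′ x ⟩
        χ ν (transp b (b + D) x)                            ≡⟨ moved⇒transp mν _ ⟩
        χ λ′ (transp c (c + D) (transp b (b + D) x))        ≡⟨ cong (χ λ′)
            (transp-conj (transp c (c + D)) (transp-injective c (c + D)) b (b + D) x) ⟩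
        χ λ′ (transp (transp c (c + D) b) (transp c (c + D) (b + D)) (transp c (c + D) x))
          ≡⟨ cong₂ (λ u v → χ λ′ (transp u v (transp c (c + D) x)))
               (transp-o b≢c (true≢false cT bF ∘ sym)) (transp-o (true≢false bT cF) (b≢c ∘ +-cancelʳ D b c)) ⟩
        χ λ′ (transp b (b + D) (transp c (c + D) x))        ≡⟨ moved⇒transp mμ _ ⟨
        χ μ (transp c (c + D) x)                            ≡⟨ moved⇒transp m x ⟨
        χ ρ x                                               ∎

  reduces-partition : ∀ {d λ′ κ w} → IsPartition λ′ → Reduces d λ′ κ w → IsPartition κ
  reduces-partition p done       = p
  reduces-partition p (rem r rs) = reduces-partition (proj₁ r) rs

  reduces-size : ∀ {d λ′ κ w} → IsPartition λ′ → Reduces (suc d) λ′ κ w → size λ′ ≡ size κ ℕ.+ suc d ℕ.* w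
  reduces-size {d} {κ = κ} p done = sym (trans (cong (size κ ℕ.+_) (ℕ.*-zeroʳ (suc d))) (ℕ.+-identityʳ _))
  reduces-size {d} {λ′} {κ} {suc w} p (rem {μ = μ} r rs) = begin
    size λ′                                       ≡⟨ removes-size p r ⟩
    size μ ℕ.+ suc d                              ≡⟨ cong (ℕ._+ suc d) (reduces-size (proj₁ r) rs) ⟩
    size κ ℕ.+ suc d ℕ.* w ℕ.+ suc d              ≡⟨ ℕ.+-assoc (size κ) _ _ ⟩
    size κ ℕ.+ (suc d ℕ.* w ℕ.+ suc d)            ≡⟨ cong (size κ ℕ.+_) (ℕ.+-comm (suc d ℕ.* w) (suc d)) ⟩
    size κ ℕ.+ (suc d ℕ.+ suc d ℕ.* w)            ≡⟨ cong (size κ ℕ.+_) (ℕ.*-suc (suc d) w) ⟨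
    size κ ℕ.+ suc d ℕ.* suc w                    ∎
    where open ≡-Reasoning

  -- The diamond is pushed along the reduction to the core, and at the end of the chain there is no
  -- hook left that could differ.
  hasCore-removes : ∀ {d λ′ μ κ w} → IsPartition λ′ → RemovesHook (suc d) λ′ μ → CoreWeight (suc d) λ′ κ w →
      HasCore (suc d) μ κ
  hasCore-removes p r (done , core) = contradiction (_ , r) core
  hasCore-removes p r (rem r′ rs , core) with diamond p r r′
  ... | inj₁ refl = _ , rs , core
  ... | inj₂ (ρ , rρ , rρ′) with w , rs′ , _ ← hasCore-removes (proj₁ r′) rρ′ (rs , core) = suc w , rem rρ rs′ , core

  core-hasCore : ∀ {d κ} → IsCore d κ → HasCore d κ κ
  core-hasCore core = 0 , done , core

  hasCore-core : ∀ {d κ κ′} → IsCore d κ → HasCore d κ κ′ → κ ≡ κ′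
  hasCore-core core (_ , done , _)    = refl
  hasCore-core core (_ , rem r _ , _) = contradiction (_ , r) core

  hasCore-unique : ∀ {d λ′ κ κ′} → IsPartition λ′ → HasCore (suc d) λ′ κ → HasCore (suc d) λ′ κ′ → κ ≡ κ′
  hasCore-unique p h (_ , done , core) = sym (hasCore-core core h)
  hasCore-unique p h (_ , rem r rs , core) = hasCore-unique (proj₁ r) (hasCore-removes p r (proj₂ h)) (_ , rs , core)

  SameCore : ℕ → List ℕ → List ℕ → Set
  SameCore d λ′ μ = ∀ κ → (HasCore d λ′ κ → HasCore d μ κ) × (HasCore d μ κ → HasCore d λ′ κ)

  sameCore-refl : ∀ {d λ′} → SameCore d λ′ λ′
  sameCore-refl κ = id , id

  sameCore-trans : ∀ {d λ′ μ ν} → SameCore d λ′ μ → SameCore d μ ν → SameCore d λ′ ν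
  sameCore-trans h h′ κ = proj₁ (h′ κ) ∘ proj₁ (h κ) , proj₂ (h κ) ∘ proj₂ (h′ κ)

  sameCore-sym : ∀ {d λ′ μ} → SameCore d λ′ μ → SameCore d μ λ′
  sameCore-sym h κ = proj₂ (h κ) , proj₁ (h κ)

  removes⇒sameCore : ∀ {d λ′ μ} → IsPartition λ′ → RemovesHook (suc d) λ′ μ → SameCore (suc d) λ′ μ
  removes⇒sameCore p r κ = (λ (w , cw) → hasCore-removes p r cw) , λ (w , rs , core) → suc w , rem r rs , core

  -- A symmetric window: positions up to `- bound` are occupied and positions beyond `bound` are
  -- free.
  bound : List ℕ → ℕ
  bound ps = length ps ℕ.+ part ps 0

  χ-low : ∀ ps {x} → x ≤ - + bound ps → χ ps x ≡ true
  χ-low ps {x} h = χ-below ps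
      (ℤ.≤-trans (ℤ.+-monoˡ-≤ (+ length ps) h)
      (ℤ.≤-trans (ℤ.≤-reflexive (lemma (+ length ps) (+ part ps 0))) (ℤ.neg-≤-pos {part ps 0} {0})))
    where
    lemma : ∀ l p → - (l + p) + l ≡ - p
    lemma = solve-∀

  χ-high : ∀ {ps x} → IsPartition ps → + bound ps < x → χ ps x ≡ false
  χ-high {ps} (w , _) h = χ-above w (ℤ.≤-<-trans (+≤+ (ℕ.m≤n+m (part ps 0) (length ps))) h)

  χ-false⇒> : ∀ ps {x} → χ ps x ≡ false → - + bound ps < x
  χ-false⇒> ps f = ℤ.≰⇒> λ le → contradiction (trans (sym (χ-low ps le)) f) λ ()

  χ-true⇒bounded : ∀ {ps x} → IsPartition ps → χ ps x ≡ true → x ≤ + bound ps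
  χ-true⇒bounded {ps} p t = ℤ.≮⇒≥ λ lt → contradiction (trans (sym t) (χ-high p lt)) λ ()

  -- A free position exceeds `- L` and an occupied one is at most `L`, so a search over `L + L`
  -- offsets from `- L` misses no removable hook.
  removable-or-core : ∀ d {ps} → IsPartition ps →
    (∃[ b ] (χ ps b ≡ false × χ ps (b + + suc d) ≡ true)) ⊎ IsCore (suc d) ps
  removable-or-core d {ps} p
    with ℕ.anyUpTo? (λ k → (χ ps (- + L + + k) Bool.≟ false) ×-dec (χ ps (- + L + + k + + suc d) Bool.≟ true))
        (L ℕ.+ L)
    where L = bound ps
  ... | yes (k , _ , bits) = inj₁ (_ , bits)
  ... | no none = inj₂ λ (μ , r) → let (b , moved cT bF _ _ _) = removes⇒moved p r in
    none (index b bF cT)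
    where
    L = bound ps
    index : ∀ b → χ ps b ≡ false → χ ps (b + + suc d) ≡ true →
      ∃[ k ] (k ℕ.< L ℕ.+ L × χ ps (- + L + + k) ≡ false × χ ps (- + L + + k + + suc d) ≡ true)
    index b bF cT with k , refl ← pos-diff (χ-false⇒> ps bF) = suc k , k< , bF , cT
      where
      lemma : ∀ l k → l + (- l + k) ≡ k
      lemma = solve-∀
      k< : suc k ℕ.< L ℕ.+ L
      k< = ℤ.drop‿+<+ (subst (_< + L + + L) (lemma (+ L) (+ suc k))
             (ℤ.+-monoʳ-< (+ L) (ℤ.<-≤-trans (b<b+d (- + L + + suc k) d) (χ-true⇒bounded p cT))))

  -- Exchanging two positions at distance d is a hook removal, a hook addition or void.
  swap-bits : ∀ d {λ′} b → IsPartition λ′ → ∃[ μ ]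
      (IsPartition μ × χ μ ≗ χ λ′ ∘ transp b (b + + suc d) × SameCore (suc d) λ′ μ ×
    ((χ λ′ b ≡ true × χ λ′ (b + + suc d) ≡ false) ⊎
     (size μ ℕ.≤ size λ′ × (χ λ′ b ≡ false → χ λ′ (b + + suc d) ≡ true → size μ ℕ.< size λ′))))
  swap-bits d {λ′} b p with χ λ′ b in eb | χ λ′ (b + + suc d) in ec
  ... | true | true = λ′ , p , transp-bits (χ λ′) (trans eb (sym ec)) , sameCore-refl , inj₂ (ℕ.≤-refl , λ ())
  ... | false | false = λ′ , p , transp-bits (χ λ′) (trans eb (sym ec)) , sameCore-refl , inj₂ (ℕ.≤-refl , λ _ ())
  ... | false | true with μ , r , sz , mv ← move-down {d} p ec eb =
    μ , proj₁ r , moved⇒transp mv , removes⇒sameCore p r , inj₂ (ℕ.<⇒≤ lt , λ _ _ → lt)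
    where
    lt : size μ ℕ.< size λ′
    lt = subst (size μ ℕ.<_) (sym sz) (ℕ.m<m+n (size μ) (s≤s z≤n))
  ... | true | false with μ , q , r , mv ← move-up {d} p eb ec =
    μ , q , moved⇒transp⁻ mv , sameCore-sym (removes⇒sameCore q r) , inj₁ (refl , refl)

  -- The transposition of a and a + (k + 2) d is a conjugate, by that of a and a + d, of the
  -- transposition of a + d and a + (k + 2) d.
  swap-bits-suc : ∀ d k {λ′} a → IsPartition λ′ →
    ∃[ μ ] (IsPartition μ × χ μ ≗ χ λ′ ∘ transp a (a + + (suc k ℕ.* suc d)) × SameCore (suc d) λ′ μ)
  swap-bits-suc d zero {λ′} a p with μ , q , e , c , _ ← swap-bits d a p =
    μ , q , subst (λ z → χ μ ≗ χ λ′ ∘ transp a (a + + z)) (sym (ℕ.+-identityʳ (suc d))) e , c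
  swap-bits-suc d (suc k) {λ′} a p
    with μ₁ , q₁ , e₁ , c₁ , _ ← swap-bits d a p
    with μ₂ , q₂ , e₂ , c₂ ← swap-bits-suc d k (a + + suc d) q₁
    with μ₃ , q₃ , e₃ , c₃ , _ ← swap-bits d a q₂ = μ₃ , q₃ , eq , sameCore-trans c₁ (sameCore-trans c₂ c₃)
    where
    open ≡-Reasoning
    D = + suc d
    E = + (suc k ℕ.* suc d)
    f = transp a (a + D)
    far : f (a + D + E) ≡ a + + (suc (suc k) ℕ.* suc d)
    far = trans (transp-o (λ e → ℤ.<-irrefl (sym e) (ℤ.<-trans (b<b+d a d) (b<b+d (a + D) (d ℕ.+ k ℕ.* suc d))))
                          (λ e → b≢b+d (a + D) (d ℕ.+ k ℕ.* suc d) (sym e)))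
                (ℤ.+-assoc a D E)
    eq : χ μ₃ ≗ χ λ′ ∘ transp a (a + + (suc (suc k) ℕ.* suc d))
    eq x = begin
      χ μ₃ x                                            ≡⟨ e₃ x ⟩
      χ μ₂ (f x)                                        ≡⟨ e₂ (f x) ⟩
      χ μ₁ (transp (a + D) (a + D + E) (f x))           ≡⟨ e₁ _ ⟩
      χ λ′ (f (transp (a + D) (a + D + E) (f x)))       ≡⟨ cong (χ λ′)
          (transp-conj f (transp-injective a (a + D)) (a + D) (a + D + E) (f x)) ⟩
      χ λ′ (transp (f (a + D)) (f (a + D + E)) (f (f x)))
        ≡⟨ cong (χ λ′) (trans (cong₂ (λ u v → transp u v (f (f x))) (transp-r a (a + D)) far)
            (cong (transp a _) (transp-involutive a (a + D) x))) ⟩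
      χ λ′ (transp a (a + + (suc (suc k) ℕ.* suc d)) x) ∎

-- The exchange θ of a class with its translate

module RunnerSwaps where

  open import Data.Integer using (_+_; _-_; -_; _<_; _≤_)
  open HookRemoval using (i-j+j≡i)
  open Beads
  open Cores

  transp-sym : ∀ a c → transp a c ≗ transp c a
  transp-sym a c x = go (x ℤ.≟ a) (x ℤ.≟ c)
    where
    go : Dec (x ≡ a) → Dec (x ≡ c) → transp a c x ≡ transp c a x
    go (yes refl) _          = trans (transp-l x c) (sym (transp-r c x))
    go (no _)     (yes refl) = trans (transp-r a x) (sym (transp-l x a))
    go (no ≢a)    (no ≢c)    = trans (transp-o ≢a ≢c) (sym (transp-o ≢c ≢a))

  abstract
    -- Needed to see that a pair of opposite t-moves leaves the s-core alone; the positions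
    -- exchanged there may be any multiple of s apart, in either order.
    swap-congruent : ∀ d {λ′} a c → IsPartition λ′ → + suc d ∣ c - a →
      ∃[ μ ] (IsPartition μ × χ μ ≗ χ λ′ ∘ transp a c × SameCore (suc d) λ′ μ)
    swap-congruent d {λ′} a c p (divides (+ 0) eq) =
      λ′ , p , transp-bits (χ λ′) (cong (χ λ′) (sym (ℤ.i-j≡0⇒i≡j c a (trans eq (ℤ.*-zeroˡ (+ suc d)))))) ,
          sameCore-refl
    swap-congruent d {λ′} a c p (divides (+[1+ k ]) eq) with μ , q , e , sc ← swap-bits-suc d k a p =
      μ , q , subst (λ z → χ μ ≗ χ λ′ ∘ transp a z) c≡ e , sc
      where
      lemma : ∀ a c → a + (c - a) ≡ c
      lemma = solve-∀
      c≡ : a + + (suc k ℕ.* suc d) ≡ c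
      c≡ = trans (cong (λ z → a + z) (trans (ℤ.pos-* (suc k) (suc d)) (sym eq))) (lemma a c)
    swap-congruent d {λ′} a c p (divides -[1+ k ] eq) with μ , q , e , sc ← swap-bits-suc d k c p =
      μ , q , (λ x → trans (subst (λ z → χ μ ≗ χ λ′ ∘ transp c z) a≡ e x) (cong (χ λ′) (transp-sym c a x))) , sc
      where
      lemma : ∀ a c → c - (c - a) ≡ a
      lemma = solve-∀
      a≡ : c + + (suc k ℕ.* suc d) ≡ a
      a≡ = trans (cong (λ z → c + z)
          (trans (ℤ.pos-* (suc k) (suc d)) (trans (ℤ.neg-distribˡ-* -[1+ k ] (+ suc d)) (cong -_ (sym eq)))))
          (lemma a c)

  i+j-j≡i : ∀ i j → i + j - j ≡ i
  i+j-j≡i = solve-∀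

  <suc⇒< : ∀ {x c} → x ≢ c → x < ℤ.suc c → x < c
  <suc⇒< {x} {c} x≢c lt = ℤ.≤∧≢⇒< (subst (x ≤_) (ℤ.pred-suc c) (ℤ.i<j⇒i≤pred[j] lt)) x≢c

  -- The set `V` is arbitrary because the same exchange serves a full class and its truncations
  -- below a cut.
  module PairSwap (T : ℤ) (V : ℤ → Set) (V? : Decidable V) (disjoint : ∀ x → V x → ¬ V (x + T)) where

    pairSwap : ℤ → ℤ
    pairSwap x with V? x
    ... | yes _ = x + T
    ... | no _ with V? (x - T)
    ...   | yes _ = x - T
    ...   | no _  = x

    data View (x : ℤ) : ℤ → Set where
      lower : V x → View x (x + T)
      upper : ¬ V x → V (x - T) → View x (x - T)
      fixed : ¬ V x → ¬ V (x - T) → View x x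

    view : ∀ x → View x (pairSwap x)
    view x with V? x
    ... | yes v = lower v
    ... | no ¬v with V? (x - T)
    ...   | yes v  = upper ¬v v
    ...   | no ¬v′ = fixed ¬v ¬v′

    swap-lower : ∀ x → V x → pairSwap x ≡ x + T
    swap-lower x v with pairSwap x | view x
    ... | _ | lower _    = refl
    ... | _ | upper ¬v _ = contradiction v ¬v
    ... | _ | fixed ¬v _ = contradiction v ¬v

    swap-upper : ∀ x → V (x - T) → pairSwap x ≡ x - T
    swap-upper x v with pairSwap x | view x
    ... | _ | lower v′   = contradiction (subst V (sym (i-j+j≡i x T)) v′) (disjoint (x - T) v)
    ... | _ | upper _ _  = refl
    ... | _ | fixed _ ¬v = contradiction v ¬v

    swap-fixed : ∀ x → ¬ V x → ¬ V (x - T) → pairSwap x ≡ x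
    swap-fixed x ¬v ¬v′ with pairSwap x | view x
    ... | _ | lower v   = contradiction v ¬v
    ... | _ | upper _ v = contradiction v ¬v′
    ... | _ | fixed _ _ = refl

    swap-involutive : ∀ x → pairSwap (pairSwap x) ≡ x
    swap-involutive x with pairSwap x | view x
    ... | _ | lower v     = trans (swap-upper (x + T) (subst V (sym (i+j-j≡i x T)) v)) (i+j-j≡i x T)
    ... | _ | upper _ v   = trans (swap-lower (x - T) v) (i-j+j≡i x T)
    ... | _ | fixed ¬v ¬v′ = swap-fixed x ¬v ¬v′

  module Runner (s′ t′ : ℕ) (U : ℤ → Set) (U? : Decidable U) (U-disjoint : ∀ x → U x → ¬ U (x + + suc t′))
    (U-+S : ∀ x → U x → U (x + + suc s′)) (U-+S⁻ : ∀ x → U (x + + suc s′) → U x) where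

    S = + suc s′
    T = + suc t′

    open PairSwap T U U? U-disjoint public
      using (lower; upper; fixed)
      renaming (pairSwap to θ; view to θ-view; swap-lower to θ-lower; swap-upper to θ-upper; swap-fixed to θ-fixed; swap-involutive to θ-involutive)

    shift-T : ∀ x → x + S - T ≡ x - T + S
    shift-T x = lemma x S T
      where
      lemma : ∀ x S T → x + S - T ≡ x - T + S
      lemma = solve-∀

    -- Both `U` and its translate by t are invariant under shifts by s. Hence θ carries a bead move
    -- from b + s to b to one from θ b + s to θ b.
    θ-+S : ∀ x → θ (x + S) ≡ θ x + S
    θ-+S x with θ x | θ-view x
    ... | _ | lower u = trans (θ-lower (x + S) (U-+S x u)) (lemma x S T)
      where
      lemma : ∀ x S T → x + S + T ≡ x + T + S
      lemma = solve-∀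
    ... | _ | upper _ u    = trans (θ-upper (x + S) (subst U (sym (shift-T x)) (U-+S (x - T) u))) (shift-T x)
    ... | _ | fixed ¬u ¬u′ = θ-fixed (x + S) (¬u ∘ U-+S⁻ x) (¬u′ ∘ U-+S⁻ (x - T) ∘ subst U (shift-T x))

    module Cut (c : ℤ) where
      open PairSwap T (λ x → U x × x < c) (λ x → U? x ×-dec (x ℤ.<? c))
          (λ x (u , _) (u′ , _) → U-disjoint x u u′) public

    open Cut using () renaming (pairSwap to θ[_])

    module _ {c} (uc : U c) where
      open Cut c using (View; lower; upper; fixed; view; swap-fixed)

      -- Raising the cut past `c` adds one transposition. The earlier pairs avoid it: `c` is not
      -- below the cut, and `c + T` and `c - T` lie outside `U`.
      θ-cut-suc : ∀ x → θ[ ℤ.suc c ] x ≡ θ[ c ] (transp c (c + T) x)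
      θ-cut-suc x with x ℤ.≟ c
      ... | yes refl = trans (Cut.swap-lower (ℤ.suc c) x (uc , x<suc c)) (sym (swap-fixed (c + T)
              (λ (u , _) → U-disjoint c uc u) (λ (_ , lt) → ℤ.<-irrefl (i+j-j≡i c T) lt)))
      ... | no x≢c with x ℤ.≟ c + T
      ...   | yes refl = trans
          (Cut.swap-upper (ℤ.suc c) x (subst (λ z → U z × z < ℤ.suc c) (sym (i+j-j≡i c T)) (uc , x<suc c)))
                           (trans (i+j-j≡i c T)
                               (sym (swap-fixed c (λ (_ , lt) → ℤ.<-irrefl refl lt)
                               (λ (u , _) → U-disjoint (c - T) u (subst U (sym (i-j+j≡i c T)) uc)))))
      ...   | no x≢c+T with θ[ c ] x | view x
      ...     | _ | lower (u , lt)   = Cut.swap-lower (ℤ.suc c) x (u , ℤ.<-trans lt (x<suc c))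
      ...     | _ | upper _ (u , lt) = Cut.swap-upper (ℤ.suc c) x (u , ℤ.<-trans lt (x<suc c))
      ...     | _ | fixed ¬v ¬v′     = Cut.swap-fixed (ℤ.suc c) x (λ (u , lt) → ¬v (u , <suc⇒< x≢c lt))
                                         (λ (u , lt) → ¬v′ (u , <suc⇒<
                                             (λ e → x≢c+T (trans (sym (i-j+j≡i x T)) (cong (_+ T) e))) lt))

    -- The pairs at which the exchange adds, respectively removes, a rim t-hook.
    Up Down : List ℕ → ℤ → Set
    Up   λ′ x = U x × χ λ′ x ≡ true × χ λ′ (x + T) ≡ false
    Down λ′ x = U x × χ λ′ x ≡ false × χ λ′ (x + T) ≡ true

    θ-cut-same : ∀ {c} → ¬ U c → ∀ x → θ[ ℤ.suc c ] x ≡ θ[ c ] x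
    θ-cut-same {c} ¬uc x with θ[ c ] x | Cut.view c x
    ... | _ | Cut.lower (u , lt)   = Cut.swap-lower (ℤ.suc c) x (u , ℤ.<-trans lt (x<suc c))
    ... | _ | Cut.upper _ (u , lt) = Cut.swap-upper (ℤ.suc c) x (u , ℤ.<-trans lt (x<suc c))
    ... | _ | Cut.fixed ¬v ¬v′     = Cut.swap-fixed (ℤ.suc c) x (λ (u , lt) → ¬v (u , <suc u lt))
        (λ (u , lt) → ¬v′ (u , <suc u lt))
      where
      <suc : ∀ {y} → U y → y < ℤ.suc c → y < c
      <suc u lt = <suc⇒< (λ { refl → ¬uc u }) lt

    module Sweep {λ′} (p : IsPartition λ′) where

      -- Below `lo` both members of a pair are occupied, so exchanging these infinitely many pairs
      -- changes nothing.
      lo : ℤ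
      lo = - + bound λ′ - T

      cut : ℕ → ℤ
      cut zero    = lo
      cut (suc m) = ℤ.suc (cut m)

      -- The estimate in `sizes` is kept only while no `Up` has been met; every pair passed has then
      -- preserved the size or, at a `Down`, lowered it.
      record Swept (c : ℤ) : Set where
        field
          μ         : List ℕ
          partition : IsPartition μ
          beads     : χ μ ≗ χ λ′ ∘ θ[ c ]
          sameCore  : SameCore (suc t′) λ′ μ
          sizes     : ∃ (Up λ′) ⊎ (size μ ℕ.≤ size λ′ × (∀ x → Down λ′ x → x < c → size μ ℕ.< size λ′))

      true-below : ∀ {x} → x < lo → χ λ′ x ≡ true × χ λ′ (x + T) ≡ true
      true-below {x} lt = χ-low λ′ (ℤ.≤-trans (ℤ.<⇒≤ (b<b+d x t′)) le) , χ-low λ′ le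
        where
        le : x + T ≤ - + bound λ′
        le = ℤ.≤-trans (ℤ.+-monoˡ-≤ T (ℤ.<⇒≤ lt)) (ℤ.≤-reflexive (i-j+j≡i (- + bound λ′) T))

      swept-lo : Swept lo
      swept-lo = record
        { μ = λ′ ; partition = p ; beads = beads ; sameCore = sameCore-refl
        ; sizes = inj₂ (ℕ.≤-refl , λ x (_ , f , _) lt → contradiction (trans (sym f) (proj₁ (true-below lt))) λ ())
        }
        where
        beads : χ λ′ ≗ χ λ′ ∘ θ[ lo ]
        beads x with θ[ lo ] x | Cut.view lo x
        ... | _ | Cut.lower (_ , lt) with t , t′ ← true-below lt = trans t (sym t′)
        ... | _ | Cut.upper _ (_ , lt) with t , t′ ← true-below lt = trans
            (trans (cong (χ λ′) (sym (i-j+j≡i x T))) t′) (sym t)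
        ... | _ | Cut.fixed _ _ = refl

      swept-suc : ∀ {c} → Swept c → Swept (ℤ.suc c)
      swept-suc {c} sw with U? c
      ... | no ¬uc = record
        { μ = μ ; partition = partition ; beads = λ x → trans (beads x)
              (cong (χ λ′) (sym (θ-cut-same ¬uc x))) ; sameCore = sameCore
        ; sizes = Sum.map₂ (λ (le , down) → le , λ x dx lt → down x dx
              (<suc⇒< (λ { refl → ¬uc (proj₁ dx) }) lt)) sizes
        }
        where open Swept sw
      ... | yes uc with ν , q , e , sc , szs ← swap-bits t′ c (Swept.partition sw) = record
        { μ = ν ; partition = q
        ; beads = λ x → trans (e x) (trans (beads _) (cong (χ λ′) (sym (θ-cut-suc uc x))))
        ; sameCore = sameCore-trans sameCore sc
        ; sizes = combine sizes szs
        }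
        where
        open Swept sw
        -- The pairs exchanged so far avoid `c` and `c + T`, so the bits of `λ′` itself decide the
        -- kind of the next exchange.
        bit-c : χ μ c ≡ χ λ′ c
        bit-c = trans (beads c) (cong (χ λ′) (Cut.swap-fixed c c (λ (_ , lt) → ℤ.<-irrefl refl lt)
                  (λ (u , _) → U-disjoint (c - T) u (subst U (sym (i-j+j≡i c T)) uc))))
        bit-c+T : χ μ (c + T) ≡ χ λ′ (c + T)
        bit-c+T = trans (beads (c + T)) (cong (χ λ′) (Cut.swap-fixed c (c + T) (λ (u , _) → U-disjoint c uc u)
                    (λ (_ , lt) → ℤ.<-irrefl (i+j-j≡i c T) lt)))
        combine : ∃ (Up λ′) ⊎ (size μ ℕ.≤ size λ′ × (∀ x → Down λ′ x → x < c → size μ ℕ.< size λ′)) →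
          ((χ μ c ≡ true × χ μ (c + T) ≡ false) ⊎
              (size ν ℕ.≤ size μ × (χ μ c ≡ false → χ μ (c + T) ≡ true → size ν ℕ.< size μ))) →
          ∃ (Up λ′) ⊎ (size ν ℕ.≤ size λ′ × (∀ x → Down λ′ x → x < ℤ.suc c → size ν ℕ.< size λ′))
        combine (inj₁ up) _ = inj₁ up
        combine (inj₂ _) (inj₁ (t , f)) = inj₁ (c , uc , trans (sym bit-c) t , trans (sym bit-c+T) f)
        combine (inj₂ (le , down)) (inj₂ (le′ , down′)) = inj₂ (ℕ.≤-trans le′ le , strict)
          where
          strict : ∀ x → Down λ′ x → x < ℤ.suc c → size ν ℕ.< size λ′
          strict x dx lt with x ℤ.≟ c
          ... | yes refl = ℕ.<-≤-trans (down′ (trans bit-c (proj₁ (proj₂ dx))) (trans bit-c+T (proj₂ (proj₂ dx)))) le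
          ... | no x≢c   = ℕ.≤-<-trans le′ (down x dx (<suc⇒< x≢c lt))

      swept : ∀ m → Swept (cut m)
      swept zero    = swept-lo
      swept (suc m) = swept-suc (swept m)

      cut-formula : ∀ m → cut m ≡ + m + lo
      cut-formula zero    = sym (ℤ.+-identityˡ lo)
      cut-formula (suc m) = trans (cong ℤ.suc (cut-formula m)) (sym (ℤ.+-assoc 1ℤ (+ m) lo))

      abstract
        swept-high : ∃[ c ] (+ bound λ′ < c × Swept c)
        -- From - bound - t up to bound + 1 the cut makes 2 bound + t + 1 steps.
        swept-high = at (suc (bound λ′ ℕ.+ (bound λ′ ℕ.+ suc t′))) (reach (bound λ′))
          where
          lemma : ∀ B T → (1ℤ + (B + (B + T))) + (- B - T) ≡ 1ℤ + B
          lemma = solve-∀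
          reach : ∀ B → + suc (B ℕ.+ (B ℕ.+ suc t′)) + (- + B - T) ≡ ℤ.suc (+ B)
          reach B = lemma (+ B) T
          at : ∀ m → + m + lo ≡ ℤ.suc (+ bound λ′) → ∃[ c ] (+ bound λ′ < c × Swept c)
          at m eq = _ , x<suc (+ bound λ′) , subst Swept (trans (cut-formula m) eq) (swept m)

      false-above : ∀ {c x} → + bound λ′ < c → ¬ x < c → χ λ′ x ≡ false × χ λ′ (x + T) ≡ false
      false-above {c} {x} B<c ≮ = χ-high p lt , χ-high p (ℤ.<-trans lt (b<b+d x t′))
        where
        lt : + bound λ′ < x
        lt = ℤ.<-≤-trans B<c (ℤ.≮⇒≥ ≮)

      θ-cut-high : ∀ {c} → + bound λ′ < c → χ λ′ ∘ θ[ c ] ≗ χ λ′ ∘ θ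
      θ-cut-high {c} B<c x with θ x | θ-view x
      ... | _ | fixed ¬u ¬u′ = cong (χ λ′) (Cut.swap-fixed c x (¬u ∘ proj₁) (¬u′ ∘ proj₁))
      ... | _ | lower u = go (x ℤ.<? c)
        where
        go : Dec (x < c) → χ λ′ (θ[ c ] x) ≡ χ λ′ (x + T)
        go (yes lt) = cong (χ λ′) (Cut.swap-lower c x (u , lt))
        go (no ≮) with f , f′ ← false-above B<c ≮ =
          trans (cong (χ λ′) (Cut.swap-fixed c x (≮ ∘ proj₂)
            (λ (u′ , _) → U-disjoint (x - T) u′ (subst U (sym (i-j+j≡i x T)) u)))) (trans f (sym f′))
      ... | _ | upper ¬u u = go (x - T ℤ.<? c)
        where
        go : Dec (x - T < c) → χ λ′ (θ[ c ] x) ≡ χ λ′ (x - T)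
        go (yes lt) = cong (χ λ′) (Cut.swap-upper c x (u , lt))
        go (no ≮) with f , f′ ← false-above B<c ≮ =
          trans (cong (χ λ′) (trans (Cut.swap-fixed c x (¬u ∘ proj₁) (≮ ∘ proj₂)) (sym (i-j+j≡i x T))))
              (trans f′ (sym f))

    record Θ (λ′ μ : List ℕ) : Set where
      constructor byBeads
      field beads : χ μ ≗ χ λ′ ∘ θ

    open Θ

    Θ-sym : ∀ {λ′ μ} → Θ λ′ μ → Θ μ λ′
    Θ-sym {λ′} h .beads x = trans (cong (χ λ′) (sym (θ-involutive x))) (sym (h .beads (θ x)))

    Θ-functional : ∀ {λ′ μ ν} → IsPartition μ → IsPartition ν → Θ λ′ μ → Θ λ′ ν → μ ≡ ν
    Θ-functional pμ pν h h′ = χ-injective pμ pν λ x → trans (h .beads x) (sym (h′ .beads x))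

    abstract
      Θ-exists : ∀ {λ′} → IsPartition λ′ → ∃[ μ ] (IsPartition μ × Θ λ′ μ × SameCore (suc t′) λ′ μ ×
        (∃ (Up λ′) ⊎ (size μ ℕ.≤ size λ′ × (∃ (Down λ′) → size μ ℕ.< size λ′))))
      Θ-exists {λ′} p with c , B<c , sw ← Sweep.swept-high p = μ , partition , byBeads
          (λ x → trans (swept-beads x) (Sweep.θ-cut-high p B<c x)) , sameCore ,
        Sum.map₂ (λ (le , down) → le , λ (x , dx) → down x dx
            (ℤ.<-≤-trans (b<b+d x t′) (ℤ.≤-trans (χ-true⇒bounded p (proj₂ (proj₂ dx))) (ℤ.<⇒≤ B<c)))) sizes
        where open Sweep.Swept sw hiding (beads)
              open Sweep.Swept sw using () renaming (beads to swept-beads)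

    abstract
      Θ-removes : ∀ {λ′ λ″ μ} → IsPartition λ′ → IsPartition λ″ → Θ λ′ λ″ → RemovesHook (suc s′) λ′ μ →
        ∃[ μ′ ] (RemovesHook (suc s′) λ″ μ′ × Θ μ μ′)
      Θ-removes {λ′} {λ″} {μ} p p′ h r with b , mv@(moved cT bF _ _ _) ← removes⇒moved p r
        with μ′ , r′ , _ , mv′ ← move-down {s′} {b = θ b} p′
               (trans (h .beads (θ b + S))
                   (trans (cong (χ λ′) (trans (cong θ (sym (θ-+S b))) (θ-involutive (b + S)))) cT))
               (trans (h .beads (θ b)) (trans (cong (χ λ′) (θ-involutive b)) bF)) = μ′ , r′ , byBeads eq
        where
        open ≡-Reasoning
        eq : χ μ′ ≗ χ μ ∘ θ
        eq x = begin
          χ μ′ x                                              ≡⟨ moved⇒transp mv′ x ⟩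
          χ λ″ (transp (θ b) (θ b + S) x)                     ≡⟨ h .beads _ ⟩
          χ λ′ (θ (transp (θ b) (θ b + S) x))                 ≡⟨ cong (χ λ′)
              (transp-conj θ (involutive⇒injective θ-involutive) (θ b) (θ b + S) x) ⟩
          χ λ′ (transp (θ (θ b)) (θ (θ b + S)) (θ x))
            ≡⟨ cong₂ (λ u v → χ λ′ (transp u v (θ x))) (θ-involutive b)
                (trans (cong θ (sym (θ-+S b))) (θ-involutive (b + S))) ⟩
          χ λ′ (transp b (b + S) (θ x))                       ≡⟨ moved⇒transp mv (θ x) ⟨
          χ μ (θ x)                                           ∎

    Θ-core : ∀ {σ σ′} → IsPartition σ → IsPartition σ′ → Θ σ σ′ → IsCore (suc s′) σ → IsCore (suc s′) σ′
    Θ-core p p′ h core (μ , r) with μ′ , r′ , _ ← Θ-removes p′ p (Θ-sym h) r = core (μ′ , r′)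

    -- The number `w` of removals is the same on both sides, which is what makes the shift of sizes
    -- constant.
    Θ-reduces : ∀ {λ′ λ″ σ σ′ w} → IsPartition λ′ → IsPartition λ″ → IsPartition σ′ → Θ λ′ λ″ → Θ σ σ′ →
      Reduces (suc s′) λ′ σ w → Reduces (suc s′) λ″ σ′ w
    Θ-reduces p p′ pσ′ h hσ done with refl ← Θ-functional p′ pσ′ h hσ = done
    Θ-reduces p p′ pσ′ h hσ (rem r rs) with _ , r′ , h′ ← Θ-removes p p′ h r =
      rem r′ (Θ-reduces (proj₁ r) (proj₁ r′) pσ′ h′ hσ rs)

-- Reduction to a common core and the equivalences

module Reduction where

  open import Data.Integer using (_+_; _-_; -_)
  open Beads
  open Cores
  open RunnerSwaps

  -- A free position at distance d below an occupied one would allow a removal, so the beads of a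
  -- core are pushed down on each runner.
  core-closed : ∀ {d σ} → IsPartition σ → IsCore (suc d) σ → ∀ k x → χ σ (x + + (k ℕ.* suc d)) ≡ true → χ σ x ≡ true
  core-closed {d} {σ} p core zero    x t = trans (cong (χ σ) (sym (ℤ.+-identityʳ x))) t
  core-closed {d} {σ} p core (suc k) x t with χ σ x in eq
  ... | true  = refl
  ... | false = contradiction (let (μ , r , _) = move-down {d} {b = x} p next eq in μ , r) core
    where
    next : χ σ (x + + suc d) ≡ true
    next = core-closed p core k (x + + suc d) (trans (cong (χ σ) (ℤ.+-assoc x (+ suc d) (+ (k ℕ.* suc d)))) t)

  hasCore-same-size : ∀ {d λ′ κ} → IsPartition λ′ → HasCore (suc d) λ′ κ → size λ′ ≡ size κ → λ′ ≡ κ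
  hasCore-same-size p (_ , done , _) eq = refl
  hasCore-same-size {d} {λ′} {κ} p (suc w , rs@(rem _ _) , _) eq =
    contradiction (trans (sym eq) (reduces-size p rs)) (ℕ.<⇒≢ (ℕ.m<m+n (size κ) (s≤s z≤n)))

  hasCore-size : ∀ {d λ′ κ} → IsPartition λ′ → HasCore (suc d) λ′ κ → size κ ℕ.≤ size λ′
  hasCore-size {κ = κ} p (_ , rs , _) = subst (size κ ℕ.≤_) (sym (reduces-size p rs)) (ℕ.m≤m+n (size κ) _)

  Cores : ℕ → ℕ → List ℕ → List ℕ → List ℕ → Set
  Cores s t σ τ λ′ = IsPartition λ′ × HasCore s λ′ σ × HasCore t λ′ τ

  -- `τ` is quantified inside the fields because θ keeps every t-core. The size law is additive to
  -- avoid truncated subtraction.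
  record Correspondence (s t : ℕ) (σ κ : List ℕ) : Set₁ where
    field
      R   : List ℕ → List ℕ → Set
      to  : ∀ {τ λ′} → Cores s t σ τ λ′ → ∃[ μ ] (R λ′ μ × Cores s t κ τ μ × size λ′ ℕ.+ size κ ≡ size μ ℕ.+ size σ)
      from : ∀ {τ μ} → Cores s t κ τ μ → ∃[ λ′ ] (R λ′ μ × Cores s t σ τ λ′ × size λ′ ℕ.+ size κ ≡ size μ ℕ.+ size σ)
      functional : ∀ {λ′ μ ν} → R λ′ μ → R λ′ ν → μ ≡ ν
      injective  : ∀ {λ′ μ ν} → R μ λ′ → R ν λ′ → μ ≡ ν

  correspondence-refl : ∀ {s t σ} → Correspondence s t σ σ
  correspondence-refl = record
    { R = _≡_
    ; to = λ c → _ , refl , c , refl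
    ; from = λ c → _ , refl , c , refl
    ; functional = λ { refl refl → refl }
    ; injective = λ { refl refl → refl }
    }

  size-compose : ∀ {l m n a b c} → l ℕ.+ b ≡ m ℕ.+ a → m ℕ.+ c ≡ n ℕ.+ b → l ℕ.+ c ≡ n ℕ.+ a
  size-compose {l} {m} {n} {a} {b} {c} e₁ e₂ = ℕ.+-cancelʳ-≡ b _ _ (begin
    l ℕ.+ c ℕ.+ b     ≡⟨ swap l c b ⟩
    l ℕ.+ b ℕ.+ c     ≡⟨ cong (ℕ._+ c) e₁ ⟩
    m ℕ.+ a ℕ.+ c     ≡⟨ swap m a c ⟩
    m ℕ.+ c ℕ.+ a     ≡⟨ cong (ℕ._+ a) e₂ ⟩
    n ℕ.+ b ℕ.+ a     ≡⟨ swap n b a ⟩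
    n ℕ.+ a ℕ.+ b     ∎)
    where
    open ≡-Reasoning
    swap : ∀ x y z → x ℕ.+ y ℕ.+ z ≡ x ℕ.+ z ℕ.+ y
    swap x y z = trans (ℕ.+-assoc x y z) (trans (cong (x ℕ.+_) (ℕ.+-comm y z)) (sym (ℕ.+-assoc x z y)))

  correspondence-trans : ∀ {s t σ σ′ κ} → Correspondence s t σ σ′ → Correspondence s t σ′ κ → Correspondence s t σ κ
  correspondence-trans {σ = σ} {σ′} {κ} P Q = record
    { R = λ λ′ ν → ∃[ μ ] (P.R λ′ μ × Q.R μ ν)
    ; to = λ {_} {λ′} c → let (μ , r , c′ , e) = P.to c ; (ν , r′ , c″ , e′) = Q.to c′ in
             ν , (μ , r , r′) , c″ , size-compose {size λ′} {size μ} {size ν} {size σ} {size σ′} e e′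
    ; from = λ {_} {ν} c → let (μ , r , c′ , e) = Q.from c ; (λ′ , r′ , c″ , e′) = P.from c′ in
             λ′ , (μ , r′ , r) , c″ , size-compose {size λ′} {size μ} {size ν} {size σ} {size σ′} e′ e
    ; functional = λ { (_ , r₁ , r₂) (_ , r₃ , r₄) → Q.functional r₂ (subst (λ z → Q.R z _) (P.functional r₃ r₁) r₄) }
    ; injective = λ { (_ , r₁ , r₂) (_ , r₃ , r₄) → P.injective r₁ (subst (λ z → P.R _ z) (Q.injective r₄ r₂) r₃) }
    }
    where
    module P = Correspondence P
    module Q = Correspondence Q

  module NonDividing (s′ t′ : ℕ) (s∤t : ¬ + suc s′ ∣ + suc t′) where

    s = suc s′
    t = suc t′
    S = + s
    T = + t

    module Class (q : ℤ) where

      U : ℤ → Set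
      U x = S ∣ x - q

      U-q : U q
      U-q = divides 0ℤ (trans (ℤ.i≡j⇒i-j≡0 {q} refl) (sym (ℤ.*-zeroˡ S)))

      U-disjoint : ∀ x → U x → ¬ U (x + T)
      U-disjoint x u u′ = s∤t (subst (S ∣_) (lemma x T q) (∣m∣n⇒∣m-n u′ u))
        where
        lemma : ∀ x T q → x + T - q - (x - q) ≡ T
        lemma = solve-∀

      U-+S : ∀ x → U x → U (x + S)
      U-+S x u = subst (S ∣_) (lemma x S q) (∣m∣n⇒∣m+n u ∣-refl)
        where
        lemma : ∀ x S q → x - q + S ≡ x + S - q
        lemma = solve-∀

      U-+S⁻ : ∀ x → U (x + S) → U x
      U-+S⁻ x u = subst (S ∣_) (lemma x S q) (∣m∣n⇒∣m-n u ∣-refl)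
        where
        lemma : ∀ x S q → x + S - q - S ≡ x - q
        lemma = solve-∀

      open Runner s′ t′ U (λ x → S ∣? x - q) U-disjoint U-+S U-+S⁻ public hiding (S; T)

      Θ-to : ∀ {σ σ′ τ λ′} → IsPartition σ → IsPartition σ′ → Θ σ σ′ → Cores s t σ τ λ′ →
        ∃[ μ ] ((IsPartition λ′ × IsPartition μ × Θ λ′ μ) × Cores s t σ′ τ μ ×
            size λ′ ℕ.+ size σ′ ≡ size μ ℕ.+ size σ)
      Θ-to {σ} {σ′} {τ} {λ′} pσ pσ′ h (p , (w , rs , core) , hτ) = go (Θ-exists p)
        where
        open ≡-Reasoning
        go : _ → _
        go (μ , pμ , hμ , sc , _) = μ , (p , pμ , hμ) ,
            (pμ , (w , rs′ , Θ-core pσ pσ′ h core) , proj₁ (sc τ) hτ) , sizes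
          where
          rs′ : Reduces s μ σ′ w
          rs′ = Θ-reduces p pμ pσ′ hμ h rs
          sizes : size λ′ ℕ.+ size σ′ ≡ size μ ℕ.+ size σ
          sizes = begin
            size λ′ ℕ.+ size σ′                     ≡⟨ cong (ℕ._+ size σ′) (reduces-size p rs) ⟩
            size σ ℕ.+ s ℕ.* w ℕ.+ size σ′          ≡⟨ ℕ.+-comm _ (size σ′) ⟩
            size σ′ ℕ.+ (size σ ℕ.+ s ℕ.* w)        ≡⟨ cong (size σ′ ℕ.+_) (ℕ.+-comm (size σ) _) ⟩
            size σ′ ℕ.+ (s ℕ.* w ℕ.+ size σ)        ≡⟨ ℕ.+-assoc (size σ′) _ _ ⟨
            size σ′ ℕ.+ s ℕ.* w ℕ.+ size σ          ≡⟨ cong (ℕ._+ size σ) (reduces-size pμ rs′) ⟨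
            size μ ℕ.+ size σ                       ∎

      Θ-correspondence : ∀ {σ σ′} → IsPartition σ → IsPartition σ′ → Θ σ σ′ → Correspondence s t σ σ′
      Θ-correspondence p p′ h = record
        { R = λ λ′ μ → IsPartition λ′ × IsPartition μ × Θ λ′ μ
        ; to = Θ-to p p′ h
        ; from = λ c → let (λ′ , (pμ , pλ , h′) , c′ , e) = Θ-to p′ p (Θ-sym h) c in
                   λ′ , (pλ , pμ , Θ-sym h′) , c′ , sym e
        ; functional = λ (_ , pμ , h₁) (_ , pν , h₂) → Θ-functional pμ pν h₁ h₂
        ; injective = λ (pμ , _ , h₁) (pν , _ , h₂) → Θ-functional pμ pν (Θ-sym h₁) (Θ-sym h₂)
        }

      -- If `x` is at or above `q`, its bead forces one at `q`; if `x` is below `q`, the bead at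
      -- `q + T` forces one at `x + T`.
      core-no-up : ∀ {σ} → IsPartition σ → IsCore s σ → χ σ q ≡ false → χ σ (q + T) ≡ true → ¬ ∃ (Up σ)
      core-no-up {σ} p core f t (x , divides (+ k) eq , tx , fx) =
        contradiction (trans (sym (core-closed p core k q (trans (cong (χ σ) x≡) tx))) f) λ ()
        where
        lemma : ∀ x q → q + (x - q) ≡ x
        lemma = solve-∀
        x≡ : q + + (k ℕ.* s) ≡ x
        x≡ = trans (cong (λ z → q + z) (trans (ℤ.pos-* k s) (sym eq))) (lemma x q)
      core-no-up {σ} p core f t (x , divides -[1+ k ] eq , tx , fx) =
        contradiction (trans (sym (core-closed p core (suc k) (x + T) (trans (cong (χ σ) q+T≡) t))) fx) λ ()
        where
        lemma : ∀ x q T → x + T - (x - q) ≡ q + T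
        lemma = solve-∀
        q+T≡ : x + T + + (suc k ℕ.* s) ≡ q + T
        q+T≡ = trans (cong (λ z → x + T + z)
            (trans (ℤ.pos-* (suc k) s) (trans (ℤ.neg-distribˡ-* -[1+ k ] S) (cong -_ (sym eq))))) (lemma x q T)

    record Reduced (σ : List ℕ) : Set₁ where
      field
        κ         : List ℕ
        partition : IsPartition κ
        s-core    : IsCore s κ
        t-core    : IsCore t κ
        hasCore   : HasCore t σ κ
        corr      : Correspondence s t σ κ

    -- `n` bounds the size, which drops strictly at each exchange: there is a `Down` at `q` and, by
    -- `core-no-up`, no `Up`.
    reduce : ∀ n {σ} → size σ ℕ.≤ n → IsPartition σ → IsCore s σ → Reduced σ
    reduce n {σ} le p core with removable-or-core t′ p
    ... | inj₂ t-core = record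
      { κ = σ ; partition = p ; s-core = core ; t-core = t-core ; hasCore = core-hasCore t-core
      ; corr = correspondence-refl }
    ... | inj₁ (q , fq , tq) = descend n le (Θ-exists p)
      where
      open Class q
      descend : ∀ n → size σ ℕ.≤ n → ∃[ μ ] (IsPartition μ × Θ σ μ × SameCore t σ μ ×
        (∃ (Up σ) ⊎ (size μ ℕ.≤ size σ × (∃ (Down σ) → size μ ℕ.< size σ)))) → Reduced σ
      descend n le (_ , _ , _ , _ , inj₁ up) = contradiction up (core-no-up p core fq tq)
      descend zero le (μ , _ , _ , _ , inj₂ (_ , down)) = contradiction
          (ℕ.<-≤-trans (down (q , U-q , fq , tq)) le) λ ()
      descend (suc n) le (μ , pμ , h , sc , inj₂ (_ , down)) = record
        { κ = I.κ ; partition = I.partition ; s-core = I.s-core ; t-core = I.t-core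
        ; hasCore = proj₂ (sc I.κ) I.hasCore
        ; corr = correspondence-trans (Θ-correspondence p pμ h) I.corr
        }
        where
        module I = Reduced (reduce n (s≤s⁻¹ (ℕ.<-≤-trans (down (q , U-q , fq , tq)) le)) pμ (Θ-core p pμ h core))

    module _ {κ} (pκ : IsPartition κ) (s-core : IsCore s κ) (t-core : IsCore t κ) where

      another : ∀ {τ λ′} → Cores s t κ τ λ′ → ∀ q → χ λ′ q ≡ false → χ λ′ (q + T) ≡ true →
        ∃[ μ ] (Cores s t κ τ μ × size μ ≡ size λ′ × μ ≢ λ′)
      another {τ} {λ′} (p , hκ@(w , rs , _) , hτ) q fq tq = go (Θ-exists p)
        where
        open Class q

        -- An `Up` of θκ is a `Down` of κ, which a t-core does not have. So applying θ once more,
        -- which returns κ, cannot enlarge θκ.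
        κ-size : ∀ {κ′} → IsPartition κ′ → Θ κ κ′ → size κ ℕ.≤ size κ′
        κ-size {κ′} pκ′ h = bound-size (Θ-exists pκ′)
          where
          bound-size : ∃[ μ ] (IsPartition μ × Θ κ′ μ × SameCore t κ′ μ ×
            (∃ (Up κ′) ⊎ (size μ ℕ.≤ size κ′ × (∃ (Down κ′) → size μ ℕ.< size κ′)))) → size κ ℕ.≤ size κ′
          bound-size (μ , pμ , h′ , _ , inj₂ (le , _)) = subst (λ z → size z ℕ.≤ size κ′)
              (Θ-functional pμ pκ h′ (Θ-sym h)) le
          bound-size (_ , _ , _ , _ , inj₁ (x , u , tx , fx)) =
            contradiction (let (ν , r , _) = move-down {t′} {b = x} pκ
                                 (trans (cong (χ κ) (sym (θ-lower x u))) (trans (sym (Θ.beads h x)) tx))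
                                 (trans (cong (χ κ) (sym
                                     (trans (θ-upper (x + T) (subst U (sym (i+j-j≡i x T)) u)) (i+j-j≡i x T))))
                                     (trans (sym (Θ.beads h (x + T))) fx))
                           in ν , r) t-core

        swap-pairs : ∀ x → Up λ′ x → ∃[ μ ] (Cores s t κ τ μ × size μ ≡ size λ′ × μ ≢ λ′)
        swap-pairs x (u , tx , fx) = build (move-down {t′} {b = q} p tq fq)
          where
          -- The four positions are distinct: `x` and `q` differ in occupancy, and the class of `q`
          -- never meets its translate by t.
          q≢q+T : q ≢ q + T
          q≢q+T = b≢b+d q t′
          x≢x+T : x ≢ x + T
          x≢x+T = b≢b+d x t′
          x≢q : x ≢ q
          x≢q = true≢false {χ λ′} tx fq
          x≢q+T : x ≢ q + T
          x≢q+T refl = U-disjoint q U-q u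
          x+T≢q : x + T ≢ q
          x+T≢q eq = U-disjoint x u (subst U (sym eq) U-q)
          x+T≢q+T : x + T ≢ q + T
          x+T≢q+T = x≢q ∘ +-cancelʳ T x q
          lemma : ∀ x q T → x - q ≡ (x + T) - (q + T)
          lemma = solve-∀

          build : ∃[ μ ] (RemovesHook t λ′ μ × size λ′ ≡ size μ ℕ.+ t × Moved (χ λ′) q (q + T) (χ μ)) →
                  ∃[ μ ] (Cores s t κ τ μ × size μ ≡ size λ′ × μ ≢ λ′)
          build (μ₁ , r₁ , sz₁ , moved _ _ q₁ q+T₁ same₁) =
            build₂ (move-up {t′} {b = x} (proj₁ r₁) (trans (same₁ x x≢q x≢q+T) tx)
                (trans (same₁ (x + T) x+T≢q x+T≢q+T) fx))
            where
            build₂ : ∃[ μ ] (IsPartition μ × RemovesHook t μ μ₁ × Moved (χ μ) x (x + T) (χ μ₁)) →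
                     ∃[ μ ] (Cores s t κ τ μ × size μ ≡ size λ′ × μ ≢ λ′)
            build₂ (μ₂ , p₂ , r₂ , moved x+T₂ x₂ _ _ same₂) =
              -- The two t-moves together exchange the bits of `q` and `x` and those of `q + T` and
              -- `x + T`. Both pairs are congruent mod s, so the s-core survives too.
              build₃ (swap-congruent s′ q x p u)
              where
              χ-q : χ μ₂ q ≡ true
              χ-q = trans (sym (same₂ q (x≢q ∘ sym) (x+T≢q ∘ sym))) q₁
              χ-q+T : χ μ₂ (q + T) ≡ false
              χ-q+T = trans (sym (same₂ (q + T) (x≢q+T ∘ sym) (x+T≢q+T ∘ sym))) q+T₁
              build₃ : ∃[ ν ] (IsPartition ν × χ ν ≗ χ λ′ ∘ transp q x × SameCore s λ′ ν) →
                       ∃[ μ ] (Cores s t κ τ μ × size μ ≡ size λ′ × μ ≢ λ′)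
              build₃ (ν₁ , pν₁ , eν₁ , scν₁) = build₄
                  (swap-congruent s′ (q + T) (x + T) pν₁ (subst (S ∣_) (lemma x q T) u))
                where
                build₄ : ∃[ ν ] (IsPartition ν × χ ν ≗ χ ν₁ ∘ transp (q + T) (x + T) × SameCore s ν₁ ν) →
                         ∃[ μ ] (Cores s t κ τ μ × size μ ≡ size λ′ × μ ≢ λ′)
                build₄ (ν₂ , pν₂ , eν₂ , scν₂) =
                  μ₂ , (p₂ , subst (λ z → HasCore s z κ) (χ-injective pν₂ p₂ agree)
                      (proj₁ (scν₂ κ) (proj₁ (scν₁ κ) hκ)) ,
                        proj₂ (removes⇒sameCore p₂ r₂ τ) (proj₁ (removes⇒sameCore p r₁ τ) hτ)) ,
                  trans (removes-size p₂ r₂) (sym sz₁) ,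
                  λ { refl → contradiction (trans (sym χ-q) fq) λ () }
                  where
                  value : ∀ {y z} → transp q x (transp (q + T) (x + T) y) ≡ z → χ ν₂ y ≡ χ λ′ z
                  value {y} e = trans (eν₂ y) (trans (eν₁ _) (cong (χ λ′) e))
                  agree : χ ν₂ ≗ χ μ₂
                  agree y = cases (y ℤ.≟ q) (y ℤ.≟ q + T) (y ℤ.≟ x) (y ℤ.≟ x + T)
                    where
                    cases : Dec (y ≡ q) → Dec (y ≡ q + T) → Dec (y ≡ x) → Dec (y ≡ x + T) → χ ν₂ y ≡ χ μ₂ y
                    cases (yes refl) _ _ _ = trans
                        (value (trans (cong (transp q x) (transp-o q≢q+T (x+T≢q ∘ sym))) (transp-l q x)))
                        (trans tx (sym χ-q))
                    cases _ (yes refl) _ _ = trans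
                        (value (trans (cong (transp q x) (transp-l (q + T) (x + T)))
                        (transp-o x+T≢q (x≢x+T ∘ sym)))) (trans fx (sym χ-q+T))
                    cases _ _ (yes refl) _ = trans
                        (value (trans (cong (transp q x) (transp-o x≢q+T x≢x+T)) (transp-r q x))) (trans fq (sym x₂))
                    cases _ _ _ (yes refl) = trans
                        (value (trans (cong (transp q x) (transp-r (q + T) (x + T)))
                        (transp-o (q≢q+T ∘ sym) (x≢q+T ∘ sym)))) (trans tq (sym x+T₂))
                    cases (no a) (no b) (no c) (no d) = trans
                        (value (trans (cong (transp q x) (transp-o b d)) (transp-o a c)))
                      (trans (sym (same₁ y a b)) (same₂ y c d))

        go : ∃[ μ ] (IsPartition μ × Θ λ′ μ × SameCore t λ′ μ ×
          (∃ (Up λ′) ⊎ (size μ ℕ.≤ size λ′ × (∃ (Down λ′) → size μ ℕ.< size λ′)))) →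
          ∃[ μ ] (Cores s t κ τ μ × size μ ≡ size λ′ × μ ≢ λ′)
        go (_ , _ , _ , _ , inj₁ (x , up)) = swap-pairs x up
        go (μ , pμ , h , _ , inj₂ (_ , down)) = contradiction (down (q , U-q , fq , tq)) (ℕ.≤⇒≯ (grow (Θ-exists pκ)))
          where
          grow : ∃[ κ′ ] (IsPartition κ′ × Θ κ κ′ × SameCore t κ κ′ ×
            (∃ (Up κ) ⊎ (size κ′ ℕ.≤ size κ × (∃ (Down κ) → size κ′ ℕ.< size κ)))) → size λ′ ℕ.≤ size μ
          -- `λ′` and its image have the same s-weight, so the inequality between κ and θκ carries
          -- over to them.
          grow (κ′ , pκ′ , hκ′ , _) = ℕ.≤-trans (ℕ.≤-reflexive (reduces-size p rs))
            (ℕ.≤-trans (ℕ.+-monoˡ-≤ (s ℕ.* w) (κ-size pκ′ hκ′))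
                (ℕ.≤-reflexive (sym (reduces-size pμ (Θ-reduces p pμ pκ′ h hκ′ rs)))))

    module Main {σ τ} (pσ : IsPartition σ) (σ-core : IsCore s σ) (pτ : IsPartition τ) (τ-core : IsCore t τ)
        (n : ℕ) where

      private module K = Reduced (reduce (size σ) ℕ.≤-refl pσ σ-core)
      open K using (κ)
      private module M = Correspondence K.corr

      Condition₂ Condition₃ : Set
      Condition₂ = ∃[ κ ] (HasCore t σ κ × HasCore s τ κ × n ≡ size σ ℕ.+ size τ ℕ.∸ size κ)
      Condition₃ = IsMinimal s t σ τ n × ∃[ w ] (HasWeight t σ w × n ≡ size τ ℕ.+ t ℕ.* w)

      -- Translates between the stated condition and its additive form at the particular `κ` reached
      -- by the reduction.
      tight : HasCore s τ κ × n ℕ.+ size κ ≡ size τ ℕ.+ size σ → Condition₂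
      tight (hτ , eq) = κ , K.hasCore , hτ ,
        trans (sym (ℕ.m+n∸n≡m n (size κ))) (cong (ℕ._∸ size κ) (trans eq (ℕ.+-comm (size τ) (size σ))))

      tight⁻ : Condition₂ → HasCore s τ κ × n ℕ.+ size κ ≡ size τ ℕ.+ size σ
      tight⁻ (κ₀ , hσ , hτ , eq) = subst (HasCore s τ) κ₀≡κ hτ ,
        trans (cong (λ z → n ℕ.+ size z) (sym κ₀≡κ)) (trans (cong (ℕ._+ size κ₀) eq)
          (trans (ℕ.m∸n+n≡m (ℕ.≤-trans (hasCore-size pσ hσ) (ℕ.m≤m+n (size σ) (size τ))))
              (ℕ.+-comm (size σ) (size τ))))
        where
        κ₀≡κ : κ₀ ≡ κ
        κ₀≡κ = hasCore-unique pσ hσ K.hasCore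

      κτ-lower : ∀ {μ} → Cores s t κ τ μ → size τ ℕ.≤ size μ
      κτ-lower (p , _ , h) = hasCore-size p h

      -- The size law leaves exactly |τ| for `μ`, and a partition with t-core τ has this size only
      -- if no hook was removed.
      is-τ : ∀ {λ′ μ} → size λ′ ≡ n → n ℕ.+ size κ ≡ size τ ℕ.+ size σ → Cores s t κ τ μ →
        size λ′ ℕ.+ size κ ≡ size μ ℕ.+ size σ → μ ≡ τ
      is-τ {λ′} {μ} refl eq (p , _ , h) e = hasCore-same-size p h
          (ℕ.+-cancelʳ-≡ (size σ) (size μ) (size τ) (trans (sym e) eq))

      2⇒1 : Condition₂ → UniqueInP s t σ τ n
      2⇒1 c₂ = go (tight⁻ c₂)
        where
        go : HasCore s τ κ × n ℕ.+ size κ ≡ size τ ℕ.+ size σ → UniqueInP s t σ τ n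
        -- `τ` itself is the smallest partition with cores (κ , τ), and its partner is the partition
        -- sought.
        go (hτ , eq) = found (M.from (pτ , hτ , core-hasCore τ-core))
          where
          found : ∃[ λ′ ] (M.R λ′ τ × Cores s t σ τ λ′ × size λ′ ℕ.+ size κ ≡ size τ ℕ.+ size σ) → UniqueInP s t σ τ n
          found (λ′ , r , (p , hs , ht) , e) =
            λ′ , (p , ℕ.+-cancelʳ-≡ (size κ) _ _ (trans e (sym eq)) , hs , ht) , unique
            where
            unique : ∀ μ → InP s t σ τ n μ → μ ≡ λ′
            unique μ (p′ , sz , hs′ , ht′) = let (ν , r′ , c , e′) = M.to (p′ , hs′ , ht′) in
              M.injective (subst (M.R μ) (is-τ {μ} sz eq c e′) r′) r

      1⇒2 : UniqueInP s t σ τ n → Condition₂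
      1⇒2 (λ′ , (p , sz , hs , ht) , unique) = found (M.to (p , hs , ht))
        where
        found : ∃[ μ ] (M.R λ′ μ × Cores s t κ τ μ × size λ′ ℕ.+ size κ ≡ size μ ℕ.+ size σ) → Condition₂
        found (μ , r , c@(pμ , hsμ , htμ) , e) = split (removable-or-core t′ pμ)
          where
          split : (∃[ b ] (χ μ b ≡ false × χ μ (b + T) ≡ true)) ⊎ IsCore t μ → Condition₂
          split (inj₂ t-core) = tight
              (subst (λ z → HasCore s z κ) μ≡τ hsμ , trans (cong (ℕ._+ size κ) (sym sz))
              (trans e (cong (λ z → size z ℕ.+ size σ) μ≡τ)))
            where
            μ≡τ : μ ≡ τ
            μ≡τ = hasCore-core t-core htμ
          split (inj₁ (q , fq , tq)) = other (another K.partition K.s-core K.t-core c q fq tq)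
            where
            other : ∃[ ν ] (Cores s t κ τ ν × size ν ≡ size μ × ν ≢ μ) → Condition₂
            -- The partner of `ν` again has size `n`, so by uniqueness it is `λ′`, whose only
            -- partner is `μ`.
            other (ν , c′ , szν , ν≢μ) = let (λ″ , r′ , (p″ , hs″ , ht″) , e″) = M.from c′ in
              contradiction (M.functional (subst (λ z → M.R z ν) (unique λ″ (p″ ,
                trans (ℕ.+-cancelʳ-≡ (size κ) _ _ (trans e″ (trans (cong (ℕ._+ size σ) szν) (sym e)))) sz ,
                    hs″ , ht″)) r′) r) ν≢μ

      -- Since |σ| = |κ| + t w, the number in the third condition is the one in the second.
      σ-size : ∀ {w} → CoreWeight t σ κ w → size τ ℕ.+ t ℕ.* w ℕ.+ size κ ≡ size τ ℕ.+ size σ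
      σ-size {w} (rs , _) = trans (ℕ.+-assoc (size τ) _ _)
        (cong (size τ ℕ.+_) (trans (ℕ.+-comm (t ℕ.* w) (size κ)) (sym (reduces-size pσ rs))))

      2⇒3 : Condition₂ → Condition₃
      2⇒3 c₂ = let (λ′ , inP , _) = 2⇒1 c₂ ; (hτ , eq) = tight⁻ c₂ ; (w , cw) = K.hasCore in
        -- A partition of smaller size would correspond to one with t-core τ and size below |τ|.
        ((λ′ , inP) , λ k k<n (μ , p , sz , hs , ht) → let (ν , _ , c , e) = M.to (p , hs , ht) in
          contradiction (ℕ.+-monoˡ-≤ (size σ) (κτ-lower c))
            (ℕ.<⇒≱ (subst (ℕ._< size τ ℕ.+ size σ) (trans (cong (ℕ._+ size κ) (sym sz)) e)
              (subst (k ℕ.+ size κ ℕ.<_) eq (ℕ.+-monoˡ-< (size κ) k<n))))) ,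
        w , (κ , cw) , ℕ.+-cancelʳ-≡ (size κ) _ _ (trans eq (sym (σ-size cw)))

      3⇒2 : Condition₃ → Condition₂
      3⇒2 (((λ′ , p , sz , hs , ht) , _) , w , (κ₀ , cw) , refl) = found (M.to (p , hs , ht))
        where
        eq : n ℕ.+ size κ ≡ size τ ℕ.+ size σ
        eq = σ-size (subst (λ z → CoreWeight t σ z w) (hasCore-unique pσ (w , cw) K.hasCore) cw)
        -- The given partition of size `n` corresponds to one of size |τ| with t-core τ, hence to
        -- `τ`, which therefore has s-core κ.
        found : ∃[ μ ] (M.R λ′ μ × Cores s t κ τ μ × size λ′ ℕ.+ size κ ≡ size μ ℕ.+ size σ) → Condition₂
        found (μ , _ , c , e) = tight (subst (λ z → HasCore s z κ) (is-τ {λ′} sz eq c e) (proj₁ (proj₂ c)) , eq)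

      1⇔2 : UniqueInP s t σ τ n ⇔ Condition₂
      1⇔2 = mk⇔ 1⇒2 2⇒1

      1⇔3 : UniqueInP s t σ τ n ⇔ Condition₃
      1⇔3 = mk⇔ (2⇒3 ∘ 1⇒2) (2⇒1 ∘ 3⇒2)

  coprime⇒∤ : ∀ {s t} → 1 ℕ.< s → Coprime s t → ¬ + s ∣ + t
  coprime⇒∤ 1<s cop s∣t = ℕ.<⇒≢ 1<s (sym (cop (ℕ.∣-refl , ∣⇒∣ᵤ s∣t)))

  inP-swap : ∀ {s t σ τ n λ′} → InP s t σ τ n λ′ → InP t s τ σ n λ′
  inP-swap (p , sz , hs , ht) = p , sz , ht , hs

  unique-swap : ∀ {s t σ τ n} → UniqueInP s t σ τ n → UniqueInP t s τ σ n
  unique-swap (λ′ , inP , unique) = λ′ , inP-swap inP , λ μ → unique μ ∘ inP-swap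

  minimal-swap : ∀ {s t σ τ n} → IsMinimal s t σ τ n → IsMinimal t s τ σ n
  minimal-swap ((λ′ , inP) , least) = (λ′ , inP-swap inP) , λ k k<n (μ , inP′) → least k k<n (μ , inP-swap inP′)

open import Data.Nat using (_+_; _*_; _∸_; _<_)
open Reduction

theorem5p9 : (s t : ℕ) → 1 < s → 1 < t → Coprime s t →
    (σ τ : List ℕ) → IsPartition σ → IsCore s σ → IsPartition τ → IsCore t τ →
    (n : ℕ) →
    (UniqueInP s t σ τ n ⇔
    (∃[ κ ] (HasCore t σ κ × HasCore s τ κ × n ≡ size σ + size τ ∸ size κ)))
    × (UniqueInP s t σ τ n ⇔
    (IsMinimal s t σ τ n × ∃[ w ] (HasWeight t σ w × n ≡ size τ + t * w)))
    × (UniqueInP s t σ τ n ⇔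
    (IsMinimal s t σ τ n × ∃[ w ] (HasWeight s τ w × n ≡ size σ + s * w)))
theorem5p9 s@(suc s′) t@(suc t′) 1<s 1<t cop σ τ pσ σ-core pτ τ-core n =
  ST.1⇔2 , ST.1⇔3 ,
  -- The last condition is the third one with (s , σ) and (t , τ) exchanged, a symmetry under which
  -- the set of partitions is unchanged.
  mk⇔ (λ u → let (m , w) = Equivalence.to TS.1⇔3 (unique-swap u) in minimal-swap m , w)
      (λ (m , w) → unique-swap (Equivalence.from TS.1⇔3 (minimal-swap m , w)))
  where
  module ST = NonDividing.Main s′ t′ (coprime⇒∤ 1<s cop) pσ σ-core pτ τ-core n
  module TS = NonDividing.Main t′ s′ (coprime⇒∤ 1<t (Coprimality.sym cop)) pτ τ-core pσ σ-core n
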